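{- Let $h\ge 1$ be an integer and let $T$ be a binary tree of height $h$. Then $T$ has a $(\leq 3^{h-1}-1)$-subdivision $S$ with $\phi(S)\le 8$.
   Context: An anagram is a word of the form $WP$ where $W$ is a non-empty word and $P$ is a permutation of $W$ (a word whose letters form the same multiset as those of $W$). A vertex colouring of a graph is anagram-free if the sequence of colours along every path of the graph is not an anagram. The anagram-free chromatic number $\phi(G)$ of a graph $G$ is the minimum number of colours in an anagram-free colouring of $G$. A subdivision of $G$ is a graph obtained by replacing each edge $uv$ by a path with endpoints $u,v$; the internal vertices of these paths are division vertices, and the vertices of $G$ are original vertices. A $(\le k)$-subdivision is a subdivision in which every edge is subdivided at most $k$ times, i.e. receives at most $k$ division vertices. A binary tree is a rooted tree in which every vertex has at most $2$ children; its height is the maximum distance from the root to a vertex. -}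

module Defs where

open import Data.Nat using (ℕ; zero; suc; _≤_; _⊔_)
open import Data.Fin using (Fin)
open import Data.List using (List; []; _∷_; _++_; map)
open import Data.List.Relation.Unary.Linked using (Linked)
open import Data.List.Relation.Unary.Unique.Propositional using (Unique)
open import Data.List.Relation.Binary.Permutation.Propositional using (_↭_)
open import Data.Product using (Σ; _×_; ∃)
open import Data.Sum using (_⊎_)
open import Relation.Binary.PropositionalEquality using (_≡_)
open import Relation.Nullary using (¬_)

data BTree : Set where
  lf : BTree
  un : BTree → BTree
  bi : BTree → BTree → BTree

height : BTree → ℕ
height lf = zero
height (un t) = suc (height t)
height (bi s t) = suc (height s ⊔ height t)

-- un^d t : a chain of d extra vertices above t (the d division vertices of an edge)
chain : ℕ → BTree → BTree
chain zero t = t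
chain (suc d) t = un (chain d t)

-- SubdivisionOf k T S : S is a (≤ k)-subdivision of T, i.e. S is obtained from T
-- by replacing every edge (parent-child) by a path with at most k internal vertices.
data SubdivisionOf (k : ℕ) : BTree → BTree → Set where
  sub-lf : SubdivisionOf k lf lf
  sub-un : ∀ {t s} (d : ℕ) → d ≤ k → SubdivisionOf k t s →
           SubdivisionOf k (un t) (un (chain d s))
  sub-bi : ∀ {t₁ t₂ s₁ s₂} (d₁ d₂ : ℕ) → d₁ ≤ k → d₂ ≤ k →
           SubdivisionOf k t₁ s₁ → SubdivisionOf k t₂ s₂ →
           SubdivisionOf k (bi t₁ t₂) (bi (chain d₁ s₁) (chain d₂ s₂))

data Pos : BTree → Set where
  here  : ∀ {t} → Pos t
  down  : ∀ {t} → Pos t → Pos (un t)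
  left  : ∀ {t₁ t₂} → Pos t₁ → Pos (bi t₁ t₂)
  right : ∀ {t₁ t₂} → Pos t₂ → Pos (bi t₁ t₂)

data _⇝_ : {t : BTree} → Pos t → Pos t → Set where
  ⇝down  : ∀ {t} → _⇝_ {un t} here (down here)
  ⇝left  : ∀ {t₁ t₂} → _⇝_ {bi t₁ t₂} here (left here)
  ⇝right : ∀ {t₁ t₂} → _⇝_ {bi t₁ t₂} here (right here)
  in-down  : ∀ {t} {p q : Pos t} → p ⇝ q → down p ⇝ down q
  in-left  : ∀ {t₁ t₂} {p q : Pos t₁} → p ⇝ q → left {t₂ = t₂} p ⇝ left q
  in-right : ∀ {t₁ t₂} {p q : Pos t₂} → p ⇝ q → right {t₁ = t₁} p ⇝ right q

Adjacent : {t : BTree} → Pos t → Pos t → Set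
Adjacent p q = (p ⇝ q) ⊎ (q ⇝ p)

IsPath : {t : BTree} → List (Pos t) → Set
IsPath ps = Linked Adjacent ps × Unique ps

IsAnagram : {A : Set} → List A → Set
IsAnagram {A} w = Σ A λ a → Σ (List A) λ W → Σ (List A) λ P →
  (P ↭ (a ∷ W)) × (w ≡ (a ∷ W) ++ P)

AnagramFree : {t : BTree} {C : Set} → (Pos t → C) → Set
AnagramFree {t} c = (ps : List (Pos t)) → IsPath ps → ¬ IsAnagram (map c ps)

φ≤ : BTree → ℕ → Set
φ≤ S m = Σ (Pos S → Fin m) AnagramFree

{-# OPTIONS --safe #-}
-- Keränen's word w on four letters, the fixed point of an 85-uniform morphism, is anagram-free: the three cuts that
-- delimit two adjacent anagrams, taken modulo 85, satisfy a congruence that a functional modulo the determinant of the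
-- morphism detects, and by a finite search every solution of it lets the cuts be rounded to block boundaries so that,
-- the incidence matrix being invertible, their preimages delimit a shorter pair of adjacent anagrams.
--
-- The eight colours are pairs of a direction (left, right) and a letter of w. Below a branching vertex of T with subtrees
-- of height at most n, both edges get 2ⁿ − 1 division vertices, which makes them longer than the remaining depth below. Every
-- vertex takes the direction of the last turn above it, and along each path from the root the vertices of one direction
-- spell a prefix of w. If a path with a turn at a vertex v were an anagram whose midpoint lies on, say, the right of v, then the left
-- part is confined to its first edge, as otherwise it has more left vertices than the second half of the path. Hence the
-- right vertices of the path lie on one descending path, and its two halves cut a factor of w into two anagrams.
module Submission where

open import Defs

open import Data.Bool using (Bool; true; false; T; _∧_; _∨_; not; if_then_else_)
open import Data.Bool.Properties using (T-∧)
open import Data.Empty using (⊥; ⊥-elim)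
open import Data.Fin using (Fin; zero; suc; combine; remQuot)
open import Data.Fin.Properties using (remQuot-combine)
open import Data.List using (List; []; _∷_; _++_; drop; length; map; reverse; take; _ʳ++_)
open import Data.List.Membership.Propositional using (_∈_)
open import Data.List.Membership.Propositional.Properties using (∈-++⁺ʳ)
open import Data.List.Properties hiding (sum-++)
open import Data.List.Relation.Binary.Permutation.Propositional using (_↭_; ↭-sym; ↭⇒↭ₛ)
open import Data.List.Relation.Binary.Permutation.Propositional.Properties using (↭-reverse; map⁺)
import Data.List.Relation.Binary.Permutation.Setoid.Properties as Permutation
open import Data.List.Relation.Unary.All as All using (All; []; _∷_)
open import Data.List.Relation.Unary.AllPairs as AllPairs using ([]; _∷_)
open import Data.List.Relation.Unary.Any using (here; there)
import Data.List.Relation.Unary.Any.Properties as Any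
open import Data.List.Relation.Unary.Linked as Linked using (Linked; []; [-]; _∷_)
import Data.List.Relation.Unary.Linked.Properties as Linked
open import Data.List.Relation.Unary.Unique.Propositional using (Unique)
import Data.List.Relation.Unary.Unique.Propositional.Properties as Unique
open import Data.Nat
open import Data.Nat.DivMod
open import Data.Nat.ListAction using (sum)
open import Data.Nat.ListAction.Properties using (sum-++; sum-↭)
open import Data.Nat.Properties
open import Algebra.Properties.CommutativeSemigroup +-commutativeSemigroup using (interchange)
open import Data.Nat.Solver using (module +-*-Solver)
open import Data.Product using (Σ; ∃; _×_; _,_; proj₁; proj₂)
open import Data.Sum as Sum using (_⊎_; inj₁; inj₂)
open import Data.Unit using (tt)
open import Function using (_∘_)
open import Function.Bundles using (Equivalence)
open import Relation.Binary.Definitions using (tri<; tri≈; tri>)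
open import Relation.Binary.PropositionalEquality
open import Relation.Nullary using (¬_; yes; no)

-- Anagram-free words

sumBelow : (ℕ → ℕ) → ℕ → ℕ
sumBelow u zero = 0
sumBelow u (suc n) = sumBelow u n + u n

sumBelow-cong : ∀ {u v} n → (∀ {i} → i < n → u i ≡ v i) → sumBelow u n ≡ sumBelow v n
sumBelow-cong zero eq = refl
sumBelow-cong (suc n) eq = cong₂ _+_ (sumBelow-cong n (eq ∘ m<n⇒m<1+n)) (eq (n<1+n n))

sumBelow-+ : ∀ u m n → sumBelow u (m + n) ≡ sumBelow u m + sumBelow (u ∘ (m +_)) n
sumBelow-+ u m zero = trans (cong (sumBelow u) (+-identityʳ m)) (sym (+-identityʳ _))
sumBelow-+ u m (suc n) = begin
  sumBelow u (m + suc n)                                     ≡⟨ cong (sumBelow u) (+-suc m n) ⟩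
  sumBelow u (m + n) + u (m + n)                             ≡⟨ cong (_+ u (m + n)) (sumBelow-+ u m n) ⟩
  sumBelow u m + sumBelow (u ∘ (m +_)) n + u (m + n)         ≡⟨ +-assoc (sumBelow u m) _ _ ⟩
  sumBelow u m + (sumBelow (u ∘ (m +_)) n + u (m + n))       ∎
  where open ≡-Reasoning

sumBelow-affine : ∀ D K u n → sumBelow (λ i → D * u i + K) n ≡ D * sumBelow u n + K * n
sumBelow-affine D K u zero = sym (cong₂ _+_ (*-zeroʳ D) (*-zeroʳ K))
sumBelow-affine D K u (suc n) = begin
  sumBelow (λ i → D * u i + K) n + (D * u n + K)   ≡⟨ cong (_+ (D * u n + K)) (sumBelow-affine D K u n) ⟩
  D * sumBelow u n + K * n + (D * u n + K)
    ≡⟨ solve 5 (λ D K t x n → D :* t :+ K :* n :+ (D :* x :+ K) := D :* (t :+ x) :+ K :* (con 1 :+ n)) refl D K (sumBelow u n) (u n) n ⟩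
  D * (sumBelow u n + u n) + K * suc n             ∎
  where open ≡-Reasoning
        open +-*-Solver

sumBelow-* : ∀ D u n → sumBelow (λ i → D * u i) n ≡ D * sumBelow u n
sumBelow-* D u zero = sym (*-zeroʳ D)
sumBelow-* D u (suc n) = trans (cong (_+ D * u n) (sumBelow-* D u n)) (sym (*-distribˡ-+ D (sumBelow u n) (u n)))

sumBelow-1 : ∀ n → sumBelow (λ _ → 1) n ≡ n
sumBelow-1 zero = refl
sumBelow-1 (suc n) = trans (+-comm _ 1) (cong suc (sumBelow-1 n))

-- The value of every weight f on the prefixes of lengths n₁ and n₃ averages to that on the prefix of length n₂:
-- the factors between n₁, n₂ and n₂, n₃ are anagrams of each other.
Balanced : {A : Set} → (ℕ → A) → ℕ → ℕ → ℕ → Set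
Balanced {A} w n₁ n₂ n₃ = (f : A → ℕ) →
  sumBelow (f ∘ w) n₁ + sumBelow (f ∘ w) n₃ ≡ sumBelow (f ∘ w) n₂ + sumBelow (f ∘ w) n₂

AnagramFreeWord : {A : Set} → (ℕ → A) → Set
AnagramFreeWord w = ∀ n₁ n₂ n₃ → n₁ < n₂ → n₂ < n₃ → ¬ Balanced w n₁ n₂ n₃

Balanced⇒midpoint : ∀ {A : Set} {w : ℕ → A} n₁ n₂ n₃ → Balanced w n₁ n₂ n₃ → n₁ + n₃ ≡ n₂ + n₂
Balanced⇒midpoint n₁ n₂ n₃ bal with bal (λ _ → 1)
... | e rewrite sumBelow-1 n₁ | sumBelow-1 n₂ | sumBelow-1 n₃ = e

+-exchange : ∀ x y s s′ t t′ → x + s ≡ y + s′ → s + t′ ≡ s′ + t → x + t ≡ y + t′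
+-exchange x y s s′ t t′ e₁ e₂ = +-cancelʳ-≡ s′ _ _ (begin
  x + t + s′     ≡⟨ +-assoc x t s′ ⟩
  x + (t + s′)   ≡⟨ cong (x +_) (trans (+-comm t s′) (sym e₂)) ⟩
  x + (s + t′)   ≡⟨ sym (+-assoc x s t′) ⟩
  x + s + t′     ≡⟨ cong (_+ t′) e₁ ⟩
  y + s′ + t′    ≡⟨ +-assoc y s′ t′ ⟩
  y + (s′ + t′)  ≡⟨ cong (y +_) (+-comm s′ t′) ⟩
  y + (t′ + s′)  ≡⟨ sym (+-assoc y t′ s′) ⟩
  y + t′ + s′    ∎)
  where open ≡-Reasoning

-- A strictly decreasing triple with midpoint `y` would have `x ≥ z + 2`, so the slack of one in
-- `x ≤ suc z` does no harm.
strict-midpoint : ∀ {x y z} → x + z ≡ y + y → (x ≡ y → y ≡ z → ⊥) → x ≤ suc z → x < y × y < z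
strict-midpoint {x} {y} {z} mid distinct x≤1+z with <-cmp x y | <-cmp y z
... | tri< l _ _ | tri< l′ _ _ = l , l′
... | tri< l _ _ | tri≈ _ e _  = ⊥-elim (<⇒≢ (+-mono-<-≤ l (≤-reflexive (sym e))) mid)
... | tri< l _ _ | tri> _ _ l′ = ⊥-elim (<⇒≢ (+-mono-< l l′) mid)
... | tri≈ _ e _ | tri< l′ _ _ = ⊥-elim (>⇒≢ (+-mono-≤-< (≤-reflexive (sym e)) l′) mid)
... | tri≈ _ e _ | tri≈ _ e′ _ = ⊥-elim (distinct e e′)
... | tri≈ _ e _ | tri> _ _ l′ = ⊥-elim (<⇒≢ (+-mono-≤-< (≤-reflexive e) l′) mid)
... | tri> _ _ l | tri< l′ _ _ = ⊥-elim (>⇒≢ (+-mono-< l l′) mid)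
... | tri> _ _ l | tri≈ _ e′ _ = ⊥-elim (>⇒≢ (+-mono-<-≤ l (≤-reflexive e′)) mid)
... | tri> _ _ l | tri> _ _ l′ = ⊥-elim (<⇒≱ (≤-<-trans l′ l) x≤1+z)

bump : Bool → ℕ → ℕ
bump α q = if α then suc q else q

q≤bump : ∀ α q → q ≤ bump α q
q≤bump true q = n≤1+n q
q≤bump false q = ≤-refl

bump≤1+q : ∀ α q → bump α q ≤ suc q
bump≤1+q true q = ≤-refl
bump≤1+q false q = n≤1+n q

bump-injective : ∀ α {p q} → bump α p ≡ bump α q → p ≡ q
bump-injective true = suc-injective
bump-injective false e = e

-- Infinite descent for fixed points of uniform morphisms

module UniformMorphism (A : Set) (k : ℕ) {{_ : NonZero k}} (g : A → ℕ → A) where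

  blockSum : (A → ℕ) → A → ℕ → ℕ
  blockSum f x r = sumBelow (f ∘ g x) r

  len : Bool → ℕ
  len α = if α then k else 0

  -- Moving each cut r to the start (α false) or the end (α true) of its block turns balanced cuts into balanced cuts.
  Rounds : (α₁ α₂ α₃ : Bool) (x₁ x₂ x₃ : A) (r₁ r₂ r₃ : ℕ) → Set
  Rounds α₁ α₂ α₃ x₁ x₂ x₃ r₁ r₂ r₃ =
    (f : A → ℕ) → blockSum f x₁ r₁ + blockSum f x₃ r₃ + (blockSum f x₂ (len α₂) + blockSum f x₂ (len α₂))
                ≡ blockSum f x₂ r₂ + blockSum f x₂ r₂ + (blockSum f x₁ (len α₁) + blockSum f x₃ (len α₃))

  -- A consequence of the three moved cuts coinciding that can be read off the blocks alone.
  Collapsed : (α₁ α₂ α₃ : Bool) (x₁ x₂ x₃ : A) (r₁ r₂ r₃ : ℕ) → Set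
  Collapsed α₁ α₂ α₃ x₁ x₂ x₃ r₁ r₂ r₃ =
    (α₁ ≡ α₂ → x₁ ≡ x₂) × (α₂ ≡ α₃ → x₂ ≡ x₃) × (α₁ ≡ α₃ → x₁ ≡ x₃) ×
    (r₁ + len α₂ < r₂ + len α₁) × (r₂ + len α₃ < r₃ + len α₂)

  module FixedPoint (x₀ : A) (start : g x₀ 0 ≡ x₀) (2<k : 2 < k) where

    -- The letter at `n` lies in the image of the letter at `n / k`. Fuel replaces well-founded
    -- recursion: `n` units suffice because division by `k` lowers every positive position, and
    -- surplus units only reapply `g x₀ 0 ≡ x₀`.
    iterate : ℕ → ℕ → A
    iterate zero n = x₀
    iterate (suc fuel) n = g (iterate fuel (n / k)) (n % k)

    word : ℕ → A
    word n = iterate n n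

    n≤1+i⇒n/k≤i : ∀ {n i} → n ≤ suc i → n / k ≤ i
    n≤1+i⇒n/k≤i {zero} _ = ≤-trans (≤-reflexive (0/n≡0 k)) z≤n
    n≤1+i⇒n/k≤i {suc n} (s≤s l) = ≤-trans (s≤s⁻¹ (m/n<m (suc n) k (<-trans ≤-refl 2<k))) l

    iterate-stable : ∀ i {n} → n ≤ i → iterate (suc i) n ≡ iterate i n
    iterate-stable zero z≤n = trans (cong (g x₀) (m<n⇒m%n≡m (<-trans (s≤s z≤n) 2<k))) start
    iterate-stable (suc i) {n} l = cong (λ x → g x (n % k)) (iterate-stable i (n≤1+i⇒n/k≤i l))

    iterate-word : ∀ {i n} → n ≤ i → iterate i n ≡ word n
    iterate-word {i} l = go (≤⇒≤′ l)
      where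
      go : ∀ {i n} → n ≤′ i → iterate i n ≡ word n
      go ≤′-refl = refl
      go (≤′-step l) = trans (iterate-stable _ (≤′⇒≤ l)) (go l)

    word-fixed : ∀ n → word n ≡ g (word (n / k)) (n % k)
    word-fixed n = trans (sym (iterate-stable n ≤-refl))
                         (cong (λ x → g x (n % k)) (iterate-word (m/n≤m n k)))

    word-block : ∀ q {r} → r < k → word (q * k + r) ≡ g (word q) r
    word-block q {r} r<k = trans (word-fixed (q * k + r)) (cong₂ (g ∘ word) quot rem)
      where
      rem : (q * k + r) % k ≡ r
      rem = trans (cong (_% k) (+-comm (q * k) r)) (trans ([m+kn]%n≡m%n r q k) (m<n⇒m%n≡m r<k))
      quot : (q * k + r) / k ≡ q
      quot = trans (+-distrib-/ (q * k) r lt) (trans (cong₂ _+_ (m*n/n≡m q k) (m<n⇒m/n≡0 r<k)) (+-identityʳ q))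
        where lt : (q * k) % k + r % k < k
              lt = subst (_< k) (sym (cong₂ _+_ (m*n%n≡0 q k) (m<n⇒m%n≡m r<k))) r<k

    -- Proved together with `sumBelow-tail`, where `r` may equal `k`: a full tail is the step from
    -- `q` to `suc q` blocks.
    sumBelow-blocks : ∀ f q → sumBelow (f ∘ word) (q * k) ≡ sumBelow (λ i → blockSum f (word i) k) q
    sumBelow-tail : ∀ f q {r} → r ≤ k →
      sumBelow (f ∘ word) (q * k + r) ≡ sumBelow (λ i → blockSum f (word i) k) q + blockSum f (word q) r
    sumBelow-blocks f zero = refl
    sumBelow-blocks f (suc q) = trans (cong (sumBelow (f ∘ word)) (+-comm k (q * k))) (sumBelow-tail f q ≤-refl)
    sumBelow-tail f q {r} r≤k = trans (sumBelow-+ (f ∘ word) (q * k) r)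
      (cong₂ _+_ (sumBelow-blocks f q) (sumBelow-cong r (λ i<r → cong f (word-block q (<-≤-trans i<r r≤k)))))

    sumBelow-divMod : ∀ f n → sumBelow (f ∘ word) n
      ≡ sumBelow (λ i → blockSum f (word i) k) (n / k) + blockSum f (word (n / k)) (n % k)
    sumBelow-divMod f n = trans (cong (sumBelow (f ∘ word)) (trans (m≡m%n+[m/n]*n n k) (+-comm (n % k) _)))
                                (sumBelow-tail f (n / k) (<⇒≤ (m%n<n n k)))

    sumBelow-bump : ∀ f α q → sumBelow (λ i → blockSum f (word i) k) (bump α q)
      ≡ sumBelow (λ i → blockSum f (word i) k) q + blockSum f (word q) (len α)
    sumBelow-bump f true q = refl
    sumBelow-bump f false q = sym (+-identityʳ _)

    -- Whole blocks are invisible to `φ` modulo `N`, so the balance of `φ` constrains only the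
    -- partial blocks at the three cuts, and `absorb` rounds every solution of this constraint.
    -- `invert` is invertibility of the incidence matrix, with `D` clearing denominators and `K`
    -- compensating for negative entries.
    module AnagramFreeness
      (N : ℕ) {{_ : NonZero N}} (φ : A → ℕ) (ψ : A → ℕ)
      (φ-block : ∀ x → blockSum φ x k ≡ N * ψ x)
      (absorb : ∀ x₁ x₂ x₃ r₁ r₂ r₃ → r₁ < k → r₂ < k → r₃ < k →
        r₃ ≡ (r₂ + r₂ + (k ∸ r₁)) % k →
        (blockSum φ x₁ r₁ + blockSum φ x₃ r₃) % N ≡ (blockSum φ x₂ r₂ + blockSum φ x₂ r₂) % N →
        ∃ λ α₁ → ∃ λ α₂ → ∃ λ α₃ →
          Rounds α₁ α₂ α₃ x₁ x₂ x₃ r₁ r₂ r₃ × ¬ Collapsed α₁ α₂ α₃ x₁ x₂ x₃ r₁ r₂ r₃)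
      (D : ℕ) {{_ : NonZero D}}
      (invert : (h : A → ℕ) → Σ (A → ℕ) λ f → Σ ℕ λ K → ∀ x → blockSum f x k ≡ D * h x + K)
      where

      module Step (n₁ n₂ n₃ : ℕ) (n₁<n₂ : n₁ < n₂) (n₂<n₃ : n₂ < n₃) (bal : Balanced word n₁ n₂ n₃) where
        q₁ = n₁ / k
        q₂ = n₂ / k
        q₃ = n₃ / k
        r₁ = n₁ % k
        r₂ = n₂ % k
        r₃ = n₃ % k

        B : (A → ℕ) → ℕ → ℕ
        B f q = sumBelow (λ i → blockSum f (word i) k) q

        R : (A → ℕ) → ℕ → ℕ
        R f n = blockSum f (word (n / k)) (n % k)

        split : ∀ f → (B f q₁ + R f n₁) + (B f q₃ + R f n₃) ≡ (B f q₂ + R f n₂) + (B f q₂ + R f n₂)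
        split f = trans (sym (cong₂ _+_ (sumBelow-divMod f n₁) (sumBelow-divMod f n₃)))
                        (trans (bal f) (cong₂ _+_ (sumBelow-divMod f n₂) (sumBelow-divMod f n₂)))

        φ-cong : (R φ n₁ + R φ n₃) % N ≡ (R φ n₂ + R φ n₂) % N
        φ-cong = begin
          (R φ n₁ + R φ n₃) % N                              ≡⟨ sym ([m+kn]%n≡m%n (R φ n₁ + R φ n₃) (b q₁ + b q₃) N) ⟩
          (R φ n₁ + R φ n₃ + (b q₁ + b q₃) * N) % N          ≡⟨ cong (_% N) eq ⟩
          (R φ n₂ + R φ n₂ + (b q₂ + b q₂) * N) % N          ≡⟨ [m+kn]%n≡m%n (R φ n₂ + R φ n₂) (b q₂ + b q₂) N ⟩
          (R φ n₂ + R φ n₂) % N                              ∎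
          where
          open ≡-Reasoning
          open +-*-Solver
          b : ℕ → ℕ
          b = sumBelow (ψ ∘ word)
          B≡ : ∀ q → B φ q ≡ N * b q
          B≡ q = trans (sumBelow-cong q (λ {i} _ → φ-block (word i))) (sumBelow-* N (ψ ∘ word) q)
          rearrange : ∀ N x y s t → s + t + (x + y) * N ≡ (N * x + s) + (N * y + t)
          rearrange = solve 5 (λ N x y s t → s :+ t :+ (x :+ y) :* N := (N :* x :+ s) :+ (N :* y :+ t)) refl
          eq : R φ n₁ + R φ n₃ + (b q₁ + b q₃) * N ≡ R φ n₂ + R φ n₂ + (b q₂ + b q₂) * N
          eq = begin
            R φ n₁ + R φ n₃ + (b q₁ + b q₃) * N ≡⟨ rearrange N (b q₁) (b q₃) (R φ n₁) (R φ n₃) ⟩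
            (N * b q₁ + R φ n₁) + (N * b q₃ + R φ n₃)
              ≡⟨ sym (cong₂ (λ x y → (x + R φ n₁) + (y + R φ n₃)) (B≡ q₁) (B≡ q₃)) ⟩
            (B φ q₁ + R φ n₁) + (B φ q₃ + R φ n₃) ≡⟨ split φ ⟩
            (B φ q₂ + R φ n₂) + (B φ q₂ + R φ n₂) ≡⟨ cong (λ x → (x + R φ n₂) + (x + R φ n₂)) (B≡ q₂) ⟩
            (N * b q₂ + R φ n₂) + (N * b q₂ + R φ n₂) ≡⟨ sym (rearrange N (b q₂) (b q₂) (R φ n₂) (R φ n₂)) ⟩
            R φ n₂ + R φ n₂ + (b q₂ + b q₂) * N ∎

        -- This is the relation `n₁ + n₃ ≡ n₂ + n₂` modulo `k`, with `k ∸ r₁` in place of minus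
        -- `r₁`; that shift costs the one extra block in `q₁ + q₃ + 1`.
        r₃≡ : r₃ ≡ (r₂ + r₂ + (k ∸ r₁)) % k
        r₃≡ = sym (begin
          (r₂ + r₂ + (k ∸ r₁)) % k                         ≡⟨ sym ([m+kn]%n≡m%n _ (q₂ + q₂) k) ⟩
          (r₂ + r₂ + (k ∸ r₁) + (q₂ + q₂) * k) % k         ≡⟨ cong (_% k) eq ⟩
          (r₃ + (q₁ + q₃ + 1) * k) % k                     ≡⟨ [m+kn]%n≡m%n r₃ (q₁ + q₃ + 1) k ⟩
          r₃ % k                                           ≡⟨ m<n⇒m%n≡m (m%n<n n₃ k) ⟩
          r₃                                               ∎)
          where
          open ≡-Reasoning
          open +-*-Solver
          mid : (r₁ + q₁ * k) + (r₃ + q₃ * k) ≡ (r₂ + q₂ * k) + (r₂ + q₂ * k)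
          mid = trans (sym (cong₂ _+_ (m≡m%n+[m/n]*n n₁ k) (m≡m%n+[m/n]*n n₃ k)))
                (trans (Balanced⇒midpoint {w = word} n₁ n₂ n₃ bal) (cong₂ _+_ (m≡m%n+[m/n]*n n₂ k) (m≡m%n+[m/n]*n n₂ k)))
          k≡ : (k ∸ r₁) + r₁ ≡ k
          k≡ = m∸n+n≡m (<⇒≤ (m%n<n n₁ k))
          eq : r₂ + r₂ + (k ∸ r₁) + (q₂ + q₂) * k ≡ r₃ + (q₁ + q₃ + 1) * k
          eq = begin
            r₂ + r₂ + (k ∸ r₁) + (q₂ + q₂) * k
              ≡⟨ solve 4 (λ r s q k → r :+ r :+ s :+ (q :+ q) :* k := ((r :+ q :* k) :+ (r :+ q :* k)) :+ s) refl r₂ (k ∸ r₁) q₂ k ⟩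
            (r₂ + q₂ * k) + (r₂ + q₂ * k) + (k ∸ r₁)  ≡⟨ cong (_+ (k ∸ r₁)) (sym mid) ⟩
            (r₁ + q₁ * k) + (r₃ + q₃ * k) + (k ∸ r₁)
              ≡⟨ solve 5 (λ r x t y s → (r :+ x) :+ (t :+ y) :+ s := (s :+ r) :+ (t :+ (x :+ y))) refl r₁ (q₁ * k) r₃ (q₃ * k) (k ∸ r₁) ⟩
            (k ∸ r₁) + r₁ + (r₃ + (q₁ * k + q₃ * k))  ≡⟨ cong (_+ (r₃ + (q₁ * k + q₃ * k))) k≡ ⟩
            k + (r₃ + (q₁ * k + q₃ * k))
              ≡⟨ solve 4 (λ k r x y → k :+ (r :+ (x :* k :+ y :* k)) := r :+ (x :+ y :+ con 1) :* k) refl k r₃ q₁ q₃ ⟩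
            r₃ + (q₁ + q₃ + 1) * k ∎

        found = absorb (word q₁) (word q₂) (word q₃) r₁ r₂ r₃ (m%n<n n₁ k) (m%n<n n₂ k) (m%n<n n₃ k) r₃≡ φ-cong
        α₁ = proj₁ found
        α₂ = proj₁ (proj₂ found)
        α₃ = proj₁ (proj₂ (proj₂ found))
        rounds = proj₁ (proj₂ (proj₂ (proj₂ found)))
        ¬collapsed = proj₂ (proj₂ (proj₂ (proj₂ found)))

        m₁ = bump α₁ q₁
        m₂ = bump α₂ q₂
        m₃ = bump α₃ q₃

        -- `rounds` trades the partial blocks at the cuts for full or empty ones, so the block
        -- boundaries `m₁`, `m₂`, `m₃` inherit the balance of the cuts.
        blocks-balanced : ∀ f → B f m₁ + B f m₃ ≡ B f m₂ + B f m₂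
        blocks-balanced f = begin
          B f m₁ + B f m₃                ≡⟨ cong₂ _+_ (sumBelow-bump f α₁ q₁) (sumBelow-bump f α₃ q₃) ⟩
          (B f q₁ + t₁) + (B f q₃ + t₃)  ≡⟨ interchange (B f q₁) t₁ (B f q₃) t₃ ⟩
          (B f q₁ + B f q₃) + (t₁ + t₃)  ≡⟨ +-exchange (B f q₁ + B f q₃) (B f q₂ + B f q₂) (R f n₁ + R f n₃) (R f n₂ + R f n₂) (t₁ + t₃) (t₂ + t₂) split′ (rounds f) ⟩
          (B f q₂ + B f q₂) + (t₂ + t₂)  ≡⟨ interchange (B f q₂) (B f q₂) t₂ t₂ ⟩
          (B f q₂ + t₂) + (B f q₂ + t₂)  ≡⟨ sym (cong₂ _+_ (sumBelow-bump f α₂ q₂) (sumBelow-bump f α₂ q₂)) ⟩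
          B f m₂ + B f m₂                ∎
          where
          open ≡-Reasoning
          t₁ = blockSum f (word q₁) (len α₁)
          t₂ = blockSum f (word q₂) (len α₂)
          t₃ = blockSum f (word q₃) (len α₃)
          split′ : (B f q₁ + B f q₃) + (R f n₁ + R f n₃) ≡ (B f q₂ + B f q₂) + (R f n₂ + R f n₂)
          split′ = trans (interchange (B f q₁) (B f q₃) (R f n₁) (R f n₃))
                         (trans (split f) (interchange (B f q₂) (R f n₂) (B f q₂) (R f n₂)))

        midpoint : m₁ + m₃ ≡ m₂ + m₂
        midpoint = *-cancelˡ-≡ _ _ k (begin
          k * (m₁ + m₃)           ≡⟨ *-distribˡ-+ k m₁ m₃ ⟩
          k * m₁ + k * m₃         ≡⟨ sym (cong₂ _+_ (B1 m₁) (B1 m₃)) ⟩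
          B (λ _ → 1) m₁ + B (λ _ → 1) m₃  ≡⟨ blocks-balanced (λ _ → 1) ⟩
          B (λ _ → 1) m₂ + B (λ _ → 1) m₂  ≡⟨ cong₂ _+_ (B1 m₂) (B1 m₂) ⟩
          k * m₂ + k * m₂         ≡⟨ sym (*-distribˡ-+ k m₂ m₂) ⟩
          k * (m₂ + m₂)           ∎)
          where
          open ≡-Reasoning
          B1 : ∀ q → B (λ _ → 1) q ≡ k * q
          B1 q = begin
            B (λ _ → 1) q             ≡⟨ sumBelow-cong q (λ _ → trans (sumBelow-1 k) (sym (*-identityʳ k))) ⟩
            sumBelow (λ _ → k * 1) q  ≡⟨ sumBelow-* k (λ _ → 1) q ⟩
            k * sumBelow (λ _ → 1) q  ≡⟨ cong (k *_) (sumBelow-1 q) ⟩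
            k * q                     ∎

        -- The weight `f` from `invert` turns block sums into `D` times the sums of `h` on the
        -- preimage, up to `K` per letter. By `midpoint` the `K` terms agree on both sides, and then
        -- `D` cancels.
        balanced : Balanced word m₁ m₂ m₃
        balanced h = descend (invert h)
          where
          open ≡-Reasoning
          H : ℕ → ℕ
          H = sumBelow (h ∘ word)
          distrib : ∀ D K x y m n → D * (x + y) + K * (m + n) ≡ (D * x + K * m) + (D * y + K * n)
          distrib D K x y m n = trans (cong₂ _+_ (*-distribˡ-+ D x y) (*-distribˡ-+ K m n)) (interchange (D * x) (D * y) (K * m) (K * n))
          descend : (Σ (A → ℕ) λ f → Σ ℕ λ K → ∀ x → blockSum f x k ≡ D * h x + K) → H m₁ + H m₃ ≡ H m₂ + H m₂
          descend (f , K , inv) = *-cancelˡ-≡ _ _ D (+-cancelʳ-≡ (K * (m₁ + m₃)) _ _ (begin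
            D * (H m₁ + H m₃) + K * (m₁ + m₃)         ≡⟨ distrib D K (H m₁) (H m₃) m₁ m₃ ⟩
            (D * H m₁ + K * m₁) + (D * H m₃ + K * m₃) ≡⟨ sym (cong₂ _+_ (BH m₁) (BH m₃)) ⟩
            B f m₁ + B f m₃                           ≡⟨ blocks-balanced f ⟩
            B f m₂ + B f m₂                           ≡⟨ cong₂ _+_ (BH m₂) (BH m₂) ⟩
            (D * H m₂ + K * m₂) + (D * H m₂ + K * m₂) ≡⟨ sym (distrib D K (H m₂) (H m₂) m₂ m₂) ⟩
            D * (H m₂ + H m₂) + K * (m₂ + m₂)         ≡⟨ cong (λ m → D * (H m₂ + H m₂) + K * m) (sym midpoint) ⟩
            D * (H m₂ + H m₂) + K * (m₁ + m₃)         ∎))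
            where
            BH : ∀ q → B f q ≡ D * H q + K * q
            BH q = trans (sumBelow-cong q (λ {i} _ → inv (word i))) (sumBelow-affine D K (h ∘ word) q)

        -- The measure of the descent. Two smaller cuts force `2 ≤ n₃`, and as `k` is at least 3,
        -- even rounding up after division gives a smaller number.
        m₃<n₃ : m₃ < n₃
        m₃<n₃ = ≤-<-trans (bump≤1+q α₃ q₃) (1+q<n (≤-trans (s≤s (≤-trans (s≤s z≤n) n₁<n₂)) n₂<n₃))
          where
          1+q<n : ∀ {n} → 2 ≤ n → suc (n / k) < n
          1+q<n {n} 2≤n with n / k | m/n*n≤m n k
          ... | zero  | _  = 2≤n
          ... | suc q | le = begin-strict
            suc (suc q)   <⟨ s≤s (s≤s (s≤s (m≤m*n q 3))) ⟩
            suc q * 3     ≤⟨ *-monoʳ-≤ (suc q) 2<k ⟩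
            suc q * k     ≤⟨ le ⟩
            n             ∎
            where open ≤-Reasoning

        r+m*k : ∀ α n → n % k + bump α (n / k) * k ≡ n + len α
        r+m*k true n = begin
          n % k + (k + n / k * k)   ≡⟨ cong (n % k +_) (+-comm k _) ⟩
          n % k + (n / k * k + k)   ≡⟨ sym (+-assoc (n % k) _ k) ⟩
          n % k + n / k * k + k     ≡⟨ cong (_+ k) (sym (m≡m%n+[m/n]*n n k)) ⟩
          n + k                     ∎
          where open ≡-Reasoning
        r+m*k false n = trans (sym (m≡m%n+[m/n]*n n k)) (sym (+-identityʳ n))

        -- `n % k` minus `len α` is the signed distance from the rounded cut to `n`. If two rounded
        -- cuts coincide, these distances are ordered as the original cuts; the lengths are moved
        -- across the inequality to avoid subtraction.
        shifted-< : ∀ {n n′} α α′ → n < n′ → bump α (n / k) ≡ bump α′ (n′ / k) → n % k + len α′ < n′ % k + len α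
        shifted-< {n} {n′} α α′ n<n′ eq = +-cancelʳ-< (bump α (n / k) * k) _ _ (begin-strict
          n % k + len α′ + bump α (n / k) * k     ≡⟨ swap (n % k) (len α′) _ ⟩
          n % k + bump α (n / k) * k + len α′     ≡⟨ cong (_+ len α′) (r+m*k α n) ⟩
          n + len α + len α′                      <⟨ +-monoˡ-< (len α′) (+-monoˡ-< (len α) n<n′) ⟩
          n′ + len α + len α′                     ≡⟨ swap n′ (len α) (len α′) ⟩
          n′ + len α′ + len α                     ≡⟨ cong (_+ len α) (sym (r+m*k α′ n′)) ⟩
          n′ % k + bump α′ (n′ / k) * k + len α   ≡⟨ cong (λ m → n′ % k + m * k + len α) (sym eq) ⟩
          n′ % k + bump α (n / k) * k + len α     ≡⟨ swap (n′ % k) _ (len α) ⟩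
          n′ % k + len α + bump α (n / k) * k     ∎)
          where
          open ≤-Reasoning
          swap : ∀ x y z → x + y + z ≡ x + z + y
          swap x y z = trans (+-assoc x y z) (trans (cong (x +_) (+-comm y z)) (sym (+-assoc x z y)))

        same-letter : ∀ {q q′} α α′ → bump α q ≡ bump α′ q′ → α ≡ α′ → word q ≡ word q′
        same-letter α _ eq refl = cong word (bump-injective α eq)

        ¬collapse : m₁ ≡ m₂ → m₂ ≡ m₃ → ⊥
        ¬collapse e₁₂ e₂₃ = ¬collapsed
          ( same-letter α₁ α₂ e₁₂ , same-letter α₂ α₃ e₂₃ , same-letter α₁ α₃ (trans e₁₂ e₂₃)
          , shifted-< α₁ α₂ n₁<n₂ e₁₂ , shifted-< α₂ α₃ n₂<n₃ e₂₃ )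

        -- When the outer cuts share a block, the first may be rounded up and the last down, which
        -- reverses them by one; `strict-midpoint` tolerates exactly this.
        m₁≤1+m₃ : m₁ ≤ suc m₃
        m₁≤1+m₃ = ≤-trans (bump≤1+q α₁ q₁) (s≤s (≤-trans (/-monoˡ-≤ k (<⇒≤ (<-trans n₁<n₂ n₂<n₃))) (q≤bump α₃ q₃)))

        ordered : m₁ < m₂ × m₂ < m₃
        ordered = strict-midpoint midpoint ¬collapse m₁≤1+m₃

      word-anagramFree : AnagramFreeWord word
      word-anagramFree n₁ n₂ n₃ = go n₃ n₁ n₂ n₃ ≤-refl
        where
        go : ∀ bound n₁ n₂ n₃ → n₃ ≤ bound → n₁ < n₂ → n₂ < n₃ → ¬ Balanced word n₁ n₂ n₃
        go zero n₁ n₂ n₃ n₃≤0 n₁<n₂ n₂<n₃ bal = n≮0 (≤-trans n₂<n₃ n₃≤0)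
        go (suc bound) n₁ n₂ n₃ le n₁<n₂ n₂<n₃ bal =
          go bound m₁ m₂ m₃ (s≤s⁻¹ (≤-trans m₃<n₃ le)) (proj₁ ordered) (proj₂ ordered) balanced
          where open Step n₁ n₂ n₃ n₁<n₂ n₂<n₃ bal

-- List indexing and Boolean search

module _ {A : Set} where

  nth : A → List A → ℕ → A
  nth z [] _ = z
  nth z (x ∷ xs) zero = x
  nth z (x ∷ xs) (suc n) = nth z xs n

  nth-drop : ∀ z m xs i → nth z (drop m xs) i ≡ nth z xs (m + i)
  nth-drop z zero xs i = refl
  nth-drop z (suc m) [] i = refl
  nth-drop z (suc m) (x ∷ xs) i = nth-drop z m xs i

  nth-take : ∀ z {m} xs {i} → i < m → nth z (take m xs) i ≡ nth z xs i
  nth-take z [] (s≤s _) = refl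
  nth-take z (x ∷ xs) {zero} (s≤s _) = refl
  nth-take z (x ∷ xs) {suc i} (s≤s i<m) = nth-take z xs i<m

  nth-++ˡ : ∀ z xs {ys i} → i < length xs → nth z (xs ++ ys) i ≡ nth z xs i
  nth-++ˡ z (x ∷ xs) {i = zero} _ = refl
  nth-++ˡ z (x ∷ xs) {i = suc i} (s≤s i<n) = nth-++ˡ z xs i<n

  nth-++ʳ : ∀ z xs {ys} i → nth z (xs ++ ys) (length xs + i) ≡ nth z ys i
  nth-++ʳ z [] i = refl
  nth-++ʳ z (x ∷ xs) i = nth-++ʳ z xs i

  copies : ℕ → List A → List A
  copies zero xs = []
  copies (suc m) xs = xs ++ copies m xs

  nth-copies : ∀ z m xs {{_ : NonZero (length xs)}} {i} → i < m * length xs → nth z (copies m xs) i ≡ nth z xs (i % length xs)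
  nth-copies z (suc m) xs {i} i<n with i <? length xs
  ... | yes i<k = trans (nth-++ˡ z xs i<k) (cong (nth z xs) (sym (m<n⇒m%n≡m i<k)))
  ... | no i≮k = begin
    nth z (xs ++ copies m xs) i                            ≡⟨ cong (nth z (xs ++ copies m xs)) (sym i≡) ⟩
    nth z (xs ++ copies m xs) (length xs + j)              ≡⟨ nth-++ʳ z xs j ⟩
    nth z (copies m xs) j                                  ≡⟨ nth-copies z m xs (+-cancelˡ-< (length xs) _ _ (subst (_< suc m * length xs) (sym i≡) i<n)) ⟩
    nth z xs (j % length xs)                               ≡⟨ cong (nth z xs) (sym (trans (cong (_% length xs) (trans (sym i≡) (+-comm (length xs) j))) ([m+n]%n≡m%n j (length xs)))) ⟩
    nth z xs (i % length xs)                               ∎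
    where
    open ≡-Reasoning
    j = i ∸ length xs
    i≡ : length xs + j ≡ i
    i≡ = m+[n∸m]≡n (≮⇒≥ i≮k)

  evens : List A → List A
  evens [] = []
  evens (x ∷ []) = x ∷ []
  evens (x ∷ _ ∷ xs) = x ∷ evens xs

  nth-evens : ∀ z xs i → nth z (evens xs) i ≡ nth z xs (i + i)
  nth-evens z [] i = refl
  nth-evens z (x ∷ []) zero = refl
  nth-evens z (x ∷ []) (suc i) = refl
  nth-evens z (x ∷ y ∷ xs) zero = refl
  nth-evens z (x ∷ y ∷ xs) (suc i) = trans (nth-evens z xs i) (cong (nth z (y ∷ xs)) (sym (+-suc i i)))

-- Exhausting the second list first counts as failure, so that `zipAll-elim` needs a bound by the
-- first list only.
zipAll : (ℕ → ℕ → ℕ → Bool) → ℕ → List ℕ → List ℕ → Bool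
zipAll p i [] _ = true
zipAll p i (y ∷ ys) [] = false
zipAll p i (y ∷ ys) (z ∷ zs) = p i y z ∧ zipAll p (suc i) ys zs

-- Matching on the premise alone leaves a costly conclusion unevaluated wherever the premise fails.
_⇒_ : Bool → Bool → Bool
true ⇒ q = q
false ⇒ _ = true

⇒-elim : ∀ {p q} → T (p ⇒ q) → T p → T q
⇒-elim {true} h _ = h

⇒-intro : ∀ {p q} → (T p → T q) → T (p ⇒ q)
⇒-intro {true} h = h tt
⇒-intro {false} _ = tt

∧-elim : ∀ {p q} → T (p ∧ q) → T p × T q
∧-elim = Equivalence.to T-∧

∧-intro : ∀ {p q} → T p × T q → T (p ∧ q)
∧-intro = Equivalence.from T-∧

_==_ : Bool → Bool → Bool
true == β = β
false == β = not β

==⇒≡ : ∀ α β → T (α == β) → α ≡ β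
==⇒≡ true true _ = refl
==⇒≡ false false _ = refl

zipAll-elim : ∀ p i ys zs → T (zipAll p i ys zs) → ∀ {j} → j < length ys → T (p (i + j) (nth 0 ys j) (nth 0 zs j))
zipAll-elim p i (y ∷ ys) (z ∷ zs) h {zero} _ = subst (λ k → T (p k y z)) (sym (+-identityʳ i)) (proj₁ (∧-elim h))
zipAll-elim p i (y ∷ ys) (z ∷ zs) h {suc j} (s≤s j<n) =
  subst (λ k → T (p k (nth 0 ys j) (nth 0 zs j))) (sym (+-suc i j))
        (zipAll-elim p (suc i) ys zs (proj₂ (∧-elim {p i y z} h)) j<n)

allBelow : ℕ → (ℕ → Bool) → Bool
allBelow zero p = true
allBelow (suc n) p = p n ∧ allBelow n p

allBelow-elim : ∀ n p → T (allBelow n p) → ∀ {i} → i < n → T (p i)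
allBelow-elim (suc n) p h (s≤s i≤n) with ∧-elim {p n} h | m≤n⇒m<n∨m≡n i≤n
... | _ , hs | inj₁ i<n  = allBelow-elim n p hs i<n
... | h₀ , _ | inj₂ refl = h₀

anyBool : (Bool → Bool) → Bool
anyBool p = p false ∨ p true

anyBool-elim : ∀ p → T (anyBool p) → ∃ λ α → T (p α)
anyBool-elim p h with p false in eq
... | true  = false , subst T (sym eq) tt
... | false = true , h

anyBools : (Bool → Bool → Bool → Bool) → Bool
anyBools p = anyBool λ α → anyBool λ β → anyBool λ γ → p α β γ

anyBools-elim : ∀ p → T (anyBools p) → ∃ λ α → ∃ λ β → ∃ λ γ → T (p α β γ)
anyBools-elim p h with anyBool-elim (λ α → anyBool λ β → anyBool λ γ → p α β γ) h
... | α , h₁ with anyBool-elim (λ β → anyBool λ γ → p α β γ) h₁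
... | β , h₂ with anyBool-elim (p α β) h₂
... | γ , h₃ = α , β , γ , h₃

-- Keränen's word

module Keränen where

  Letter : Set
  Letter = Fin 4

  pattern a = zero
  pattern b = suc zero
  pattern c = suc (suc zero)
  pattern d = suc (suc (suc zero))

  same : Letter → Letter → Bool
  same a a = true
  same b b = true
  same c c = true
  same d d = true
  same _ _ = false

  same-refl : ∀ x → T (same x x)
  same-refl a = tt
  same-refl b = tt
  same-refl c = tt
  same-refl d = tt

  allLetters : (Letter → Bool) → Bool
  allLetters p = p a ∧ p b ∧ p c ∧ p d

  allLetters-elim : ∀ p → T (allLetters p) → ∀ x → T (p x)
  allLetters-elim p h with ∧-elim {p a} h
  ... | ha , h′ with ∧-elim {p b} h′
  ... | hb , h″ with ∧-elim {p c} h″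
  ... | hc , hd = λ { a → ha ; b → hb ; c → hc ; d → hd }

  indicator : Letter → Letter → ℕ
  indicator y x = if same y x then 1 else 0

  weightedSum : List Letter → (Letter → ℕ) → (Letter → ℕ) → ℕ
  weightedSum [] f u = 0
  weightedSum (j ∷ js) f u = f j * u j + weightedSum js f u

  weightedSum-+ : ∀ js f u v → weightedSum js f (λ j → u j + v j) ≡ weightedSum js f u + weightedSum js f v
  weightedSum-+ [] f u v = refl
  weightedSum-+ (j ∷ js) f u v = begin
    f j * (u j + v j) + weightedSum js f (λ j → u j + v j)             ≡⟨ cong₂ _+_ (*-distribˡ-+ (f j) (u j) (v j)) (weightedSum-+ js f u v) ⟩
    (f j * u j + f j * v j) + (weightedSum js f u + weightedSum js f v)    ≡⟨ interchange (f j * u j) (f j * v j) _ _ ⟩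
    (f j * u j + weightedSum js f u) + (f j * v j + weightedSum js f v)    ∎
    where open ≡-Reasoning

  weightedSum-cong : ∀ js f {u v} → (∀ j → u j ≡ v j) → weightedSum js f u ≡ weightedSum js f v
  weightedSum-cong [] f eq = refl
  weightedSum-cong (j ∷ js) f eq = cong₂ _+_ (cong (f j *_) (eq j)) (weightedSum-cong js f eq)

  letters : List Letter
  letters = a ∷ b ∷ c ∷ d ∷ []

  weightedSum-0 : ∀ js f → weightedSum js f (λ _ → 0) ≡ 0
  weightedSum-0 [] f = refl
  weightedSum-0 (j ∷ js) f = cong₂ _+_ (*-zeroʳ (f j)) (weightedSum-0 js f)

  weightedSum-indicator : ∀ f x → f x ≡ weightedSum letters f (λ j → indicator j x)
  weightedSum-indicator f a = solve 4 (λ x y z t → x := x :* con 1 :+ (y :* con 0 :+ (z :* con 0 :+ (t :* con 0 :+ con 0)))) refl (f a) (f b) (f c) (f d)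
    where open +-*-Solver
  weightedSum-indicator f b = solve 4 (λ x y z t → y := x :* con 0 :+ (y :* con 1 :+ (z :* con 0 :+ (t :* con 0 :+ con 0)))) refl (f a) (f b) (f c) (f d)
    where open +-*-Solver
  weightedSum-indicator f c = solve 4 (λ x y z t → z := x :* con 0 :+ (y :* con 0 :+ (z :* con 1 :+ (t :* con 0 :+ con 0)))) refl (f a) (f b) (f c) (f d)
    where open +-*-Solver
  weightedSum-indicator f d = solve 4 (λ x y z t → t := x :* con 0 :+ (y :* con 0 :+ (z :* con 0 :+ (t :* con 1 :+ con 0)))) refl (f a) (f b) (f c) (f d)
    where open +-*-Solver

  -- By linearity every weight is a combination of the four letter counts. An identity required of
  -- all weights, such as `Rounds`, thus becomes four numerical checks.
  sumBelow-weightedSum : ∀ f (u : ℕ → Letter) n → sumBelow (f ∘ u) n ≡ weightedSum letters f (λ j → sumBelow (indicator j ∘ u) n)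
  sumBelow-weightedSum f u zero = sym (weightedSum-0 letters f)
  sumBelow-weightedSum f u (suc n) = trans (cong₂ _+_ (sumBelow-weightedSum f u n) (weightedSum-indicator f (u n)))
                                       (sym (weightedSum-+ letters f (λ j → sumBelow (indicator j ∘ u) n) (λ j → indicator j (u n))))

  next : Letter → Letter
  next a = b
  next b = c
  next c = d
  next d = a

  rotate : Letter → Letter → Letter
  rotate a y = y
  rotate b y = next y
  rotate c y = next (next y)
  rotate d y = next (next (next y))

  -- Keränen's abelian-square-free morphism: the images of b, c and d are the cyclic shifts of that of a.
  block : List Letter
  block =
    a ∷ b ∷ c ∷ a ∷ c ∷ d ∷ c ∷ b ∷ c ∷ d ∷ c ∷ a ∷ d ∷ c ∷ d ∷ b ∷ d ∷
    a ∷ b ∷ a ∷ c ∷ a ∷ b ∷ a ∷ d ∷ b ∷ a ∷ b ∷ c ∷ b ∷ d ∷ b ∷ c ∷ b ∷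
    a ∷ c ∷ b ∷ c ∷ d ∷ c ∷ a ∷ c ∷ b ∷ a ∷ b ∷ d ∷ a ∷ b ∷ a ∷ c ∷ a ∷
    d ∷ c ∷ b ∷ c ∷ d ∷ c ∷ a ∷ c ∷ d ∷ b ∷ c ∷ b ∷ a ∷ c ∷ b ∷ c ∷ d ∷
    c ∷ a ∷ c ∷ d ∷ c ∷ b ∷ d ∷ c ∷ d ∷ a ∷ d ∷ b ∷ d ∷ c ∷ b ∷ c ∷ a ∷ []

  image : Letter → ℕ → Letter
  image x r = rotate x (nth a block r)

  open UniformMorphism Letter 85 image

  scan : (Letter → ℕ) → ℕ → List Letter → List ℕ
  scan f acc [] = acc ∷ []
  scan f acc (x ∷ xs) = acc ∷ scan f (acc + f x) xs

  nth-scan : ∀ f acc xs {r} → r ≤ length xs → nth 0 (scan f acc xs) r ≡ acc + sumBelow (f ∘ nth a xs) r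
  nth-scan f acc [] z≤n = sym (+-identityʳ acc)
  nth-scan f acc (x ∷ xs) z≤n = sym (+-identityʳ acc)
  nth-scan f acc (x ∷ xs) {suc r} (s≤s r≤n) = begin
    nth 0 (scan f (acc + f x) xs) r                  ≡⟨ nth-scan f (acc + f x) xs r≤n ⟩
    acc + f x + sumBelow (f ∘ nth a xs) r            ≡⟨ +-assoc acc (f x) _ ⟩
    acc + (f x + sumBelow (f ∘ nth a xs) r)          ≡⟨ cong (acc +_) (sym (sumBelow-+ (f ∘ nth a (x ∷ xs)) 1 r)) ⟩
    acc + sumBelow (f ∘ nth a (x ∷ xs)) (suc r)      ∎
    where open ≡-Reasoning

  -- The sums blockSum f x r for all r, computed in linear time.
  prefixSums : (Letter → ℕ) → Letter → List ℕ
  prefixSums f x = scan (λ y → f (rotate x y)) 0 block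

  nth-prefixSums : ∀ f x {r} → r ≤ 85 → nth 0 (prefixSums f x) r ≡ blockSum f x r
  nth-prefixSums f x = nth-scan (λ y → f (rotate x y)) 0 block

  -- Modulo 43435 = 85 · 73 · 7, the determinant of the incidence matrix of image, the integer combinations of its columns
  -- are the kernel of this functional (whose values are the powers of a fourth root of unity).
  weight : Letter → ℕ
  weight a = 1
  weight b = 30176
  weight c = 19636
  weight d = 39101

  weightQuotient : Letter → ℕ
  weightQuotient a = 43
  weightQuotient b = 47
  weightQuotient c = 40
  weightQuotient d = 44

  weight-block : ∀ x → blockSum weight x 85 ≡ 43435 * weightQuotient x
  weight-block a = refl
  weight-block b = refl
  weight-block c = refl
  weight-block d = refl

  -- f is 511 times the inverse of the incidence matrix applied to h, plus a constant that keeps the coefficients natural.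
  invert : (h : Letter → ℕ) → Σ (Letter → ℕ) λ f → Σ ℕ λ K → ∀ x → blockSum f x 85 ≡ 511 * h x + K
  invert h = f , 2316 * (h a + h b + h c + h d) , λ x → trans (sumBelow-weightedSum f (image x) 85) (eq x)
    where
    open +-*-Solver
    f : Letter → ℕ
    f a = 19 * h a + 75 * h c + 21 * h d
    f b = 21 * h a + 19 * h b + 75 * h d
    f c = 75 * h a + 21 * h b + 19 * h c
    f d = 75 * h b + 21 * h c + 19 * h d
    fa = λ x y z t → con 19 :* x :+ con 75 :* z :+ con 21 :* t
    fb = λ x y z t → con 21 :* x :+ con 19 :* y :+ con 75 :* t
    fc = λ x y z t → con 75 :* x :+ con 21 :* y :+ con 19 :* z
    fd = λ x y z t → con 75 :* y :+ con 21 :* z :+ con 19 :* t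
    col = λ p q r s x y z t → fa x y z t :* con p :+ (fb x y z t :* con q :+ (fc x y z t :* con r :+ (fd x y z t :* con s :+ con 0)))
    tot = λ x y z t → con 2316 :* (x :+ y :+ z :+ t)
    eq : ∀ x → weightedSum letters f (λ j → blockSum (indicator j) x 85) ≡ 511 * h x + 2316 * (h a + h b + h c + h d)
    -- The four constants after `col` count a, b, c and d in the image of the letter. The product
    -- with `f` has 2316 in each off-diagonal place and 2316 + 511 on the diagonal.
    eq a = solve 4 (λ x y z t → col 19 21 27 18 x y z t := con 511 :* x :+ tot x y z t) refl (h a) (h b) (h c) (h d)
    eq b = solve 4 (λ x y z t → col 18 19 21 27 x y z t := con 511 :* y :+ tot x y z t) refl (h a) (h b) (h c) (h d)
    eq c = solve 4 (λ x y z t → col 27 18 19 21 x y z t := con 511 :* z :+ tot x y z t) refl (h a) (h b) (h c) (h d)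
    eq d = solve 4 (λ x y z t → col 21 27 18 19 x y z t := con 511 :* t :+ tot x y z t) refl (h a) (h b) (h c) (h d)

  occurrences : Letter → Letter → ℕ → ℕ
  occurrences j x r = nth 0 (prefixSums (indicator j) x) r

  blockSum-weightedSum : ∀ f x {r} → r ≤ 85 → blockSum f x r ≡ weightedSum letters f (λ j → occurrences j x r)
  blockSum-weightedSum f x {r} r≤85 = trans (sumBelow-weightedSum f (image x) r)
    (weightedSum-cong letters f (λ j → sym (nth-prefixSums (indicator j) x r≤85)))

  len≤85 : ∀ α → len α ≤ 85
  len≤85 true = ≤-refl
  len≤85 false = z≤n

  agreeing? : (u v : Letter → ℕ) → Bool
  agreeing? u v = allLetters λ j → u j ≡ᵇ v j

  agreeing?-sound : ∀ u v → T (agreeing? u v) → ∀ j → u j ≡ v j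
  agreeing?-sound u v h j = ≡ᵇ⇒≡ (u j) (v j) (allLetters-elim (λ j → u j ≡ᵇ v j) h j)

  collapsed? : (α₁ α₂ α₃ : Bool) (x₁ x₂ x₃ : Letter) (r₁ r₂ r₃ : ℕ) → Bool
  collapsed? α₁ α₂ α₃ x₁ x₂ x₃ r₁ r₂ r₃ =
    ((α₁ == α₂) ⇒ same x₁ x₂) ∧ ((α₂ == α₃) ⇒ same x₂ x₃) ∧ ((α₁ == α₃) ⇒ same x₁ x₃) ∧
    (r₁ + len α₂ <ᵇ r₂ + len α₁) ∧ (r₂ + len α₃ <ᵇ r₃ + len α₂)

  rounds? : (α₁ α₂ α₃ : Bool) (x₁ x₂ x₃ : Letter) (r₁ r₂ r₃ : ℕ) → Bool
  rounds? α₁ α₂ α₃ x₁ x₂ x₃ r₁ r₂ r₃ = agreeing?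
    (λ j → n j x₁ r₁ + n j x₃ r₃ + (n j x₂ (len α₂) + n j x₂ (len α₂)))
    (λ j → n j x₂ r₂ + n j x₂ r₂ + (n j x₁ (len α₁) + n j x₃ (len α₃)))
    where n = occurrences

  -- Implied by rounds?, but much cheaper to evaluate.
  equalLengths? : (α₁ α₂ α₃ : Bool) (r₁ r₂ r₃ : ℕ) → Bool
  equalLengths? α₁ α₂ α₃ r₁ r₂ r₃ = r₁ + r₃ + (len α₂ + len α₂) ≡ᵇ r₂ + r₂ + (len α₁ + len α₃)

  absorbed? : (x₁ x₂ x₃ : Letter) (r₁ r₂ r₃ : ℕ) → Bool
  absorbed? x₁ x₂ x₃ r₁ r₂ r₃ = anyBools λ α₁ α₂ α₃ →
    equalLengths? α₁ α₂ α₃ r₁ r₂ r₃ ∧ rounds? α₁ α₂ α₃ x₁ x₂ x₃ r₁ r₂ r₃ ∧ not (collapsed? α₁ α₂ α₃ x₁ x₂ x₃ r₁ r₂ r₃)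

  module _ (α₁ α₂ α₃ : Bool) (x₁ x₂ x₃ : Letter) (r₁ r₂ r₃ : ℕ) where

    -- The search certifies that a collapse does not occur, so the test has to be complete rather
    -- than sound.
    collapsed?-complete : Collapsed α₁ α₂ α₃ x₁ x₂ x₃ r₁ r₂ r₃ → T (collapsed? α₁ α₂ α₃ x₁ x₂ x₃ r₁ r₂ r₃)
    collapsed?-complete (h₁₂ , h₂₃ , h₁₃ , l , l′) =
      ∧-intro (agree α₁ α₂ h₁₂ , ∧-intro (agree α₂ α₃ h₂₃ , ∧-intro (agree α₁ α₃ h₁₃ , ∧-intro (<⇒<ᵇ l , <⇒<ᵇ l′))))
      where
      agree : ∀ α β {x y} → (α ≡ β → x ≡ y) → T ((α == β) ⇒ same x y)
      agree α β {x} h = ⇒-intro λ eq → subst (T ∘ same x) (h (==⇒≡ α β eq)) (same-refl x)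

    rounds?-sound : r₁ < 85 → r₂ < 85 → r₃ < 85 →
      T (rounds? α₁ α₂ α₃ x₁ x₂ x₃ r₁ r₂ r₃) → Rounds α₁ α₂ α₃ x₁ x₂ x₃ r₁ r₂ r₃
    rounds?-sound l₁ l₂ l₃ h f = begin
      B x₁ r₁ + B x₃ r₃ + (B x₂ (len α₂) + B x₂ (len α₂))
        ≡⟨ cong₂ _+_ (expand x₁ x₃ (<⇒≤ l₁) (<⇒≤ l₃)) (expand x₂ x₂ (len≤85 α₂) (len≤85 α₂)) ⟩
      weightedSum letters f before + weightedSum letters f before′   ≡⟨ sym (weightedSum-+ letters f before before′) ⟩
      weightedSum letters f (λ j → before j + before′ j)
        ≡⟨ weightedSum-cong letters f (agreeing?-sound (λ j → before j + before′ j) (λ j → after j + after′ j) h) ⟩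
      weightedSum letters f (λ j → after j + after′ j)           ≡⟨ weightedSum-+ letters f after after′ ⟩
      weightedSum letters f after + weightedSum letters f after′
        ≡⟨ sym (cong₂ _+_ (expand x₂ x₂ (<⇒≤ l₂) (<⇒≤ l₂)) (expand x₁ x₃ (len≤85 α₁) (len≤85 α₃))) ⟩
      B x₂ r₂ + B x₂ r₂ + (B x₁ (len α₁) + B x₃ (len α₃))    ∎
      where
      open ≡-Reasoning
      B = blockSum f
      n = occurrences
      before before′ after after′ : Letter → ℕ
      before j = n j x₁ r₁ + n j x₃ r₃
      before′ j = n j x₂ (len α₂) + n j x₂ (len α₂)
      after j = n j x₂ r₂ + n j x₂ r₂
      after′ j = n j x₁ (len α₁) + n j x₃ (len α₃)
      expand : ∀ x y {r s} → r ≤ 85 → s ≤ 85 → B x r + B y s ≡ weightedSum letters f (λ j → n j x r + n j y s)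
      expand x y {r} {s} r≤85 s≤85 = trans (cong₂ _+_ (blockSum-weightedSum f x r≤85) (blockSum-weightedSum f y s≤85))
                                           (sym (weightedSum-+ letters f (λ j → n j x r) (λ j → n j y s)))

  absorbed?-sound : ∀ x₁ x₂ x₃ r₁ r₂ r₃ → r₁ < 85 → r₂ < 85 → r₃ < 85 → T (absorbed? x₁ x₂ x₃ r₁ r₂ r₃) →
    ∃ λ α₁ → ∃ λ α₂ → ∃ λ α₃ → Rounds α₁ α₂ α₃ x₁ x₂ x₃ r₁ r₂ r₃ × ¬ Collapsed α₁ α₂ α₃ x₁ x₂ x₃ r₁ r₂ r₃
  absorbed?-sound x₁ x₂ x₃ r₁ r₂ r₃ l₁ l₂ l₃ h = sound (anyBools-elim _ h)
    where
    T-not : ∀ {p} → T p → T (not p) → ⊥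
    T-not {true} _ ()
    L P C : Bool → Bool → Bool → Bool
    L α₁ α₂ α₃ = equalLengths? α₁ α₂ α₃ r₁ r₂ r₃
    P α₁ α₂ α₃ = rounds? α₁ α₂ α₃ x₁ x₂ x₃ r₁ r₂ r₃
    C α₁ α₂ α₃ = collapsed? α₁ α₂ α₃ x₁ x₂ x₃ r₁ r₂ r₃
    sound : (∃ λ α₁ → ∃ λ α₂ → ∃ λ α₃ → T (L α₁ α₂ α₃ ∧ P α₁ α₂ α₃ ∧ not (C α₁ α₂ α₃))) →
      ∃ λ α₁ → ∃ λ α₂ → ∃ λ α₃ → Rounds α₁ α₂ α₃ x₁ x₂ x₃ r₁ r₂ r₃ × ¬ Collapsed α₁ α₂ α₃ x₁ x₂ x₃ r₁ r₂ r₃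
    sound (α₁ , α₂ , α₃ , h) = α₁ , α₂ , α₃
      , rounds?-sound α₁ α₂ α₃ x₁ x₂ x₃ r₁ r₂ r₃ l₁ l₂ l₃ (proj₁ (∧-elim (rest h)))
      , λ col → T-not (collapsed?-complete α₁ α₂ α₃ x₁ x₂ x₃ r₁ r₂ r₃ col) (proj₂ (∧-elim {P α₁ α₂ α₃} (rest h)))
      where
      rest : T (L α₁ α₂ α₃ ∧ P α₁ α₂ α₃ ∧ not (C α₁ α₂ α₃)) → T (P α₁ α₂ α₃ ∧ not (C α₁ α₂ α₃))
      rest h = proj₂ (∧-elim {L α₁ α₂ α₃} h)

  allTriples : (Letter → Letter → Letter → Bool) → Bool
  allTriples p = allLetters λ x → allLetters λ y → allLetters λ z → p x y z

  allTriples-elim : ∀ p → T (allTriples p) → ∀ x y z → T (p x y z)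
  allTriples-elim p h x y = allLetters-elim (p x y)
    (allLetters-elim (λ y → allLetters (p x y)) (allLetters-elim (λ x → allLetters λ y → allLetters (p x y)) h x) y)

  module Search (N : ℕ) {{_ : NonZero N}} (k : ℕ) {{_ : NonZero k}}
                (u : Letter → List ℕ) (length-u : ∀ x → length (u x) ≡ k)
                (good : (x₁ x₂ x₃ : Letter) (r₁ r₂ r₃ : ℕ) → Bool) where

    test : (good′ : (r₁ r₂ r₃ : ℕ) → Bool) (r₁ v₁ r₂ v₂ v₃ : ℕ) → Bool
    test good′ r₁ v₁ r₂ v₂ v₃ = ((v₁ + v₃) % N ≡ᵇ (v₂ + v₂) % N) ⇒ good′ r₁ r₂ ((r₂ + r₂ + (k ∸ r₁)) % k)

    -- As r₂ runs up from 0, the third position runs up in steps of two, cyclically, from k ∸ r₁: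
    -- this lines the entries up so that no list is indexed inside the loop over r₂.
    row : (good′ : (r₁ r₂ r₃ : ℕ) → Bool) (t₁ t₂ t₃ : List ℕ) → ℕ → Bool
    row good′ t₁ t₂ t₃ r₁ = zipAll (test good′ r₁ (nth 0 t₁ r₁)) 0 t₂ (evens (drop (k ∸ r₁) (copies 3 t₃)))

    rows : Letter → Letter → Letter → Bool
    rows x₁ x₂ x₃ = allBelow k (row (good x₁ x₂ x₃) (u x₁) (u x₂) (u x₃))

    search : Bool
    search = allTriples rows

    search-sound : search ≡ true → ∀ x₁ x₂ x₃ r₁ r₂ r₃ → r₁ < k → r₂ < k →
      r₃ ≡ (r₂ + r₂ + (k ∸ r₁)) % k →
      (nth 0 (u x₁) r₁ + nth 0 (u x₃) r₃) % N ≡ (nth 0 (u x₂) r₂ + nth 0 (u x₂) r₂) % N →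
      T (good x₁ x₂ x₃ r₁ r₂ r₃)
    search-sound h x₁ x₂ x₃ r₁ r₂ r₃ l₁ l₂ refl eq = ⇒-elim tested (≡⇒≡ᵇ _ _ (trans (cong (λ v → (nth 0 (u x₁) r₁ + v) % N) third) eq))
      where
      open ≡-Reasoning
      zs : List ℕ
      zs = evens (drop (k ∸ r₁) (copies 3 (u x₃)))
      tested : T (test (good x₁ x₂ x₃) r₁ (nth 0 (u x₁) r₁) r₂ (nth 0 (u x₂) r₂) (nth 0 zs r₂))
      tested = zipAll-elim (test (good x₁ x₂ x₃) r₁ (nth 0 (u x₁) r₁)) 0 (u x₂) zs
        (allBelow-elim k (row (good x₁ x₂ x₃) (u x₁) (u x₂) (u x₃)) (allTriples-elim rows (subst T (sym h) tt) x₁ x₂ x₃) l₁)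
        (<-≤-trans l₂ (≤-reflexive (sym (length-u x₂))))
      cyclic : ∀ xs → length xs ≡ k → ∀ {i} → i < 3 * k → nth 0 (copies 3 xs) i ≡ nth 0 xs (i % k)
      cyclic xs refl i<3k = nth-copies 0 3 xs i<3k
      -- Three periods are enough: `k ∸ r₁` is at most `k` and each of the two `r₂` is below `k`.
      inside : (k ∸ r₁) + (r₂ + r₂) < 3 * k
      inside = <-≤-trans (+-mono-≤-< (m∸n≤m k r₁) (+-mono-< l₂ l₂)) (+-monoʳ-≤ k (+-monoʳ-≤ k (≤-reflexive (sym (+-identityʳ k)))))
      third : nth 0 zs r₂ ≡ nth 0 (u x₃) ((r₂ + r₂ + (k ∸ r₁)) % k)
      third = begin
        nth 0 zs r₂                                              ≡⟨ nth-evens 0 (drop (k ∸ r₁) (copies 3 (u x₃))) r₂ ⟩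
        nth 0 (drop (k ∸ r₁) (copies 3 (u x₃))) (r₂ + r₂)        ≡⟨ nth-drop 0 (k ∸ r₁) (copies 3 (u x₃)) (r₂ + r₂) ⟩
        nth 0 (copies 3 (u x₃)) ((k ∸ r₁) + (r₂ + r₂))           ≡⟨ cyclic (u x₃) (length-u x₃) inside ⟩
        nth 0 (u x₃) (((k ∸ r₁) + (r₂ + r₂)) % k)                ≡⟨ cong (λ i → nth 0 (u x₃) (i % k)) (+-comm (k ∸ r₁) (r₂ + r₂)) ⟩
        nth 0 (u x₃) ((r₂ + r₂ + (k ∸ r₁)) % k)                  ∎

  -- `prefixSums` has 86 entries; the sum over the full block is dropped so that the list has period
  -- 85 when repeated cyclically.
  weights : Letter → List ℕ
  weights x = take 85 (prefixSums weight x)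

  length-weights : ∀ x → length (weights x) ≡ 85
  length-weights a = refl
  length-weights b = refl
  length-weights c = refl
  length-weights d = refl

  -- The finite search, settled by evaluation: 64 triples of letters and 85² pairs `r₁`, `r₂`, which
  -- determine the third remainder.
  search-succeeds : Search.search 43435 85 weights length-weights absorbed? ≡ true
  search-succeeds = refl

  open FixedPoint a refl (s≤s (s≤s (s≤s z≤n))) public using (word)
  open FixedPoint a refl (s≤s (s≤s (s≤s z≤n))) using (module AnagramFreeness)

  nth-weights : ∀ x {r} → r < 85 → nth 0 (weights x) r ≡ blockSum weight x r
  nth-weights x r<85 = trans (nth-take 0 (prefixSums weight x) r<85) (nth-prefixSums weight x (<⇒≤ r<85))

  absorb : ∀ x₁ x₂ x₃ r₁ r₂ r₃ → r₁ < 85 → r₂ < 85 → r₃ < 85 →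
    r₃ ≡ (r₂ + r₂ + (85 ∸ r₁)) % 85 →
    (blockSum weight x₁ r₁ + blockSum weight x₃ r₃) % 43435 ≡ (blockSum weight x₂ r₂ + blockSum weight x₂ r₂) % 43435 →
    T (absorbed? x₁ x₂ x₃ r₁ r₂ r₃)
  absorb x₁ x₂ x₃ r₁ r₂ r₃ l₁ l₂ l₃ e e′ =
    Search.search-sound 43435 85 weights length-weights absorbed? search-succeeds x₁ x₂ x₃ r₁ r₂ r₃ l₁ l₂ e
      (trans (cong (_% 43435) (cong₂ _+_ (nth-weights x₁ l₁) (nth-weights x₃ l₃)))
             (trans e′ (sym (cong (_% 43435) (cong₂ _+_ (nth-weights x₂ l₂) (nth-weights x₂ l₂))))))

  keränen-anagramFree : AnagramFreeWord word
  keränen-anagramFree = AnagramFreeness.word-anagramFree 43435 weight weightQuotient weight-block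
    (λ x₁ x₂ x₃ r₁ r₂ r₃ l₁ l₂ l₃ e e′ → absorbed?-sound x₁ x₂ x₃ r₁ r₂ r₃ l₁ l₂ l₃
       (absorb x₁ x₂ x₃ r₁ r₂ r₃ l₁ l₂ l₃ e e′))
    511 invert

open Keränen using (word; keränen-anagramFree)

-- Paths in trees

module _ {A : Set} where

  linked-reverse : {R : A → A → Set} → (∀ {x y} → R x y → R y x) → ∀ {xs} → Linked R xs → Linked R (reverse xs)
  linked-reverse R-sym [] = []
  linked-reverse {R} R-sym {x ∷ xs} l = onto l [-]
    where
    onto : ∀ {x xs acc} → Linked R (x ∷ xs) → Linked R (x ∷ acc) → Linked R (xs ʳ++ (x ∷ acc))
    onto [-] l′ = l′
    onto (Rxy ∷ l) l′ = onto l (R-sym Rxy ∷ l′)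

  linked-++ʳ : {R : A → A → Set} → ∀ xs {ys} → Linked R (xs ++ ys) → Linked R ys
  linked-++ʳ [] l = l
  linked-++ʳ (x ∷ xs) l = linked-++ʳ xs (Linked.tail l)

  unique-reverse : ∀ {xs : List A} → Unique xs → Unique (reverse xs)
  unique-reverse {xs} = Permutation.Unique-resp-↭ (setoid A) (↭⇒↭ₛ (↭-sym (↭-reverse xs)))

  unique-++ʳ : ∀ (xs : List A) {ys} → Unique (xs ++ ys) → Unique ys
  unique-++ʳ [] u = u
  unique-++ʳ (x ∷ xs) u = unique-++ʳ xs (AllPairs.tail u)

  unique-disjoint : ∀ (xs : List A) {ys x} → Unique (xs ++ ys) → x ∈ xs → x ∈ ys → ⊥
  unique-disjoint (x ∷ xs) (x∉ ∷ _) (here refl) x∈ys = All.lookup x∉ (∈-++⁺ʳ xs x∈ys) refl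
  unique-disjoint (x ∷ xs) (_ ∷ u) (there x∈xs) x∈ys = unique-disjoint xs u x∈xs x∈ys

adjacent-sym : ∀ {t} {p q : Pos t} → Adjacent p q → Adjacent q p
adjacent-sym = Sum.swap

IsPath-reverse : ∀ {t} {ps : List (Pos t)} → IsPath ps → IsPath (reverse ps)
IsPath-reverse (l , u) = linked-reverse adjacent-sym l , unique-reverse u

IsPath-++ʳ : ∀ {t} (ps : List (Pos t)) {qs} → IsPath (ps ++ qs) → IsPath qs
IsPath-++ʳ ps (l , u) = linked-++ʳ ps l , unique-++ʳ ps u

adjacent-down : ∀ {t} {p q : Pos t} → Adjacent (down p) (down q) → Adjacent p q
adjacent-down (inj₁ (in-down a)) = inj₁ a
adjacent-down (inj₂ (in-down a)) = inj₂ a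

adjacent-left : ∀ {s t} {p q : Pos s} → Adjacent (left {t₂ = t} p) (left q) → Adjacent p q
adjacent-left (inj₁ (in-left a)) = inj₁ a
adjacent-left (inj₂ (in-left a)) = inj₂ a

adjacent-right : ∀ {s t} {p q : Pos t} → Adjacent (right {t₁ = s} p) (right q) → Adjacent p q
adjacent-right (inj₁ (in-right a)) = inj₁ a
adjacent-right (inj₂ (in-right a)) = inj₂ a

IsPath-down : ∀ {t} {ps : List (Pos t)} → IsPath (map down ps) → IsPath ps
IsPath-down (l , u) = Linked.map adjacent-down (Linked.map⁻ l) , Unique.map⁻ u

IsPath-left : ∀ {s t} {ps : List (Pos s)} → IsPath (map (left {t₂ = t}) ps) → IsPath ps
IsPath-left (l , u) = Linked.map adjacent-left (Linked.map⁻ l) , Unique.map⁻ u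

IsPath-right : ∀ {s t} {ps : List (Pos t)} → IsPath (map (right {t₁ = s}) ps) → IsPath ps
IsPath-right (l , u) = Linked.map adjacent-right (Linked.map⁻ l) , Unique.map⁻ u

Avoids : ∀ {t} → List (Pos t) → Set
Avoids = All (Pos.here ≢_)

avoiding-un : ∀ {t} {ps : List (Pos (un t))} → Avoids ps → ∃ λ qs → ps ≡ map down qs
avoiding-un [] = [] , refl
avoiding-un {ps = here ∷ _} (h ∷ _) = ⊥-elim (h refl)
avoiding-un {ps = down p ∷ _} (_ ∷ h) with avoiding-un h
... | qs , refl = p ∷ qs , refl

-- Every adjacency between a vertex of one subtree and a vertex outside it involves the root, so a
-- connected list that misses the root cannot change sides.
avoiding-bi : ∀ {s t} {ps : List (Pos (bi s t))} → Linked Adjacent ps → Avoids ps →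
  (∃ λ qs → ps ≡ map left qs) ⊎ (∃ λ qs → ps ≡ map right qs)
avoiding-bi {ps = []} l h = inj₁ ([] , refl)
avoiding-bi {ps = here ∷ _} l (h ∷ _) = ⊥-elim (h refl)
avoiding-bi {ps = left p ∷ []} l h = inj₁ (p ∷ [] , refl)
avoiding-bi {ps = right p ∷ []} l h = inj₂ (p ∷ [] , refl)
avoiding-bi {ps = left p ∷ q ∷ ps} (a ∷ l) (_ ∷ h) with avoiding-bi l h
... | inj₁ (qs , eq) = inj₁ (p ∷ qs , cong (left p ∷_) eq)
avoiding-bi {ps = left p ∷ right q ∷ ps} (inj₁ () ∷ l) (_ ∷ h) | inj₂ (r ∷ qs , refl)
avoiding-bi {ps = left p ∷ right q ∷ ps} (inj₂ () ∷ l) (_ ∷ h) | inj₂ (r ∷ qs , refl)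
avoiding-bi {ps = right p ∷ q ∷ ps} (a ∷ l) (_ ∷ h) with avoiding-bi l h
... | inj₂ (qs , eq) = inj₂ (p ∷ qs , cong (right p ∷_) eq)
avoiding-bi {ps = right p ∷ left q ∷ ps} (inj₁ () ∷ l) (_ ∷ h) | inj₁ (r ∷ qs , refl)
avoiding-bi {ps = right p ∷ left q ∷ ps} (inj₂ () ∷ l) (_ ∷ h) | inj₁ (r ∷ qs , refl)

data Arm : ∀ {t} → List (Pos t) → Set where
  end   : ∀ {t} → Arm {t} []
  down  : ∀ {t} {qs : List (Pos t)} → IsPath (here ∷ qs) → Arm (map down (here ∷ qs))
  left  : ∀ {s t} {qs : List (Pos s)} → IsPath (here ∷ qs) → Arm {bi s t} (map left (here ∷ qs))
  right : ∀ {s t} {qs : List (Pos t)} → IsPath (here ∷ qs) → Arm {bi s t} (map right (here ∷ qs))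

path-avoids : ∀ {t} {ps : List (Pos t)} → IsPath (here ∷ ps) → Avoids ps
path-avoids (_ , h ∷ _) = h

-- The neighbours of the root are the roots of its child subtrees. Having stepped to one of them, a
-- path without repetition never meets the root again and so stays in that subtree.
arm : ∀ {t} {ps : List (Pos t)} → IsPath (here ∷ ps) → Arm ps
arm {ps = []} _ = end
arm {un t} {p ∷ ps} path@(a ∷ l , _ ∷ u) with avoiding-un (path-avoids path)
arm {un t} {p ∷ ps} path@(inj₁ ⇝down ∷ l , _ ∷ u) | here ∷ qs , refl = down (IsPath-down (l , u))
arm {bi s t} {p ∷ ps} path@(a ∷ l , _ ∷ u) with avoiding-bi l (path-avoids path)
arm {bi s t} {p ∷ ps} path@(inj₁ ⇝left ∷ l , _ ∷ u) | inj₁ (here ∷ qs , refl) = left (IsPath-left (l , u))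
arm {bi s t} {p ∷ ps} path@(inj₁ ⇝right ∷ l , _ ∷ u) | inj₂ (here ∷ qs , refl) = right (IsPath-right (l , u))
arm {lf} {here ∷ ps} (_ , (h ∷ _) ∷ _) = ⊥-elim (h refl)

data Descent : ∀ {t} → List (Pos t) → Set where
  []    : ∀ {t} → Descent {t} []
  stop  : ∀ {t} → Descent {t} (here ∷ [])
  down  : ∀ {t} {ps : List (Pos t)} → Descent ps → Descent (here ∷ map down ps)
  left  : ∀ {s t} {ps : List (Pos s)} → Descent ps → Descent {bi s t} (here ∷ map left ps)
  right : ∀ {s t} {ps : List (Pos t)} → Descent ps → Descent {bi s t} (here ∷ map right ps)

descent : ∀ {t} {ps : List (Pos t)} → IsPath (here ∷ ps) → Descent (here ∷ ps)
descent path with arm path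
... | end = stop
... | down path′ = down (descent path′)
... | left path′ = left (descent path′)
... | right path′ = right (descent path′)

data Split {t} : List (Pos t) → Set where
  avoiding : ∀ {ps} → Avoids ps → Split ps
  meeting  : ∀ ps qs → Split (ps ++ here ∷ qs)

split : ∀ {t} (ps : List (Pos t)) → Split ps
split [] = avoiding []
split (here ∷ ps) = meeting [] ps
split (p ∷ ps) with split ps
split (p ∷ _) | meeting qs rs = meeting (p ∷ qs) rs
split (here ∷ ps) | avoiding h = meeting [] ps
split (down p ∷ ps) | avoiding h = avoiding ((λ ()) ∷ h)
split (left p ∷ ps) | avoiding h = avoiding ((λ ()) ∷ h)
split (right p ∷ ps) | avoiding h = avoiding ((λ ()) ∷ h)

-- The first three cases miss the root and keep a bare path, to be classified again in the subtree.
-- In the others the root of the tree is the top of the path (or the path is empty), and only the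
-- two forks turn there.
data Shape : ∀ {t} → List (Pos t) → Set where
  down     : ∀ {t} {ps : List (Pos t)} → IsPath ps → Shape (map down ps)
  left     : ∀ {s t} {ps : List (Pos s)} → IsPath ps → Shape {bi s t} (map left ps)
  right    : ∀ {s t} {ps : List (Pos t)} → IsPath ps → Shape {bi s t} (map right ps)
  vertical : ∀ {t} {ps : List (Pos t)} → Descent ps → Shape ps
  upward   : ∀ {t} {ps : List (Pos t)} → Descent ps → Shape (reverse ps)
  fork     : ∀ {s t} {ps qs} → Descent ps → Descent qs →
             Shape {bi s t} (reverse (map left ps) ++ here ∷ map right qs)
  fork′    : ∀ {s t} {ps qs} → Descent ps → Descent qs →
             Shape {bi s t} (reverse (map right ps) ++ here ∷ map left qs)

-- A path through the root is cut there into an upward part, read in reverse, and a downward part.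
-- Both are paths from the root.
shape : ∀ {t} {ps : List (Pos t)} → IsPath ps → Shape ps
shape {ps = ps} path with split ps
shape {lf} path | avoiding [] = vertical []
shape {lf} path | avoiding {here ∷ _} (h ∷ _) = ⊥-elim (h refl)
shape {un t} path | avoiding h with avoiding-un h
... | qs , refl = down (IsPath-down path)
shape {bi s t} path | avoiding h with avoiding-bi (proj₁ path) h
... | inj₁ (qs , refl) = left (IsPath-left path)
... | inj₂ (qs , refl) = right (IsPath-right path)
shape {t} path | meeting ps qs = subst (λ rs → Shape (rs ++ here ∷ qs)) (reverse-involutive ps) (two-arms upPath downPath disjoint)
  where
  downPath : IsPath (here ∷ qs)
  downPath = IsPath-++ʳ ps path
  upPath : IsPath (here ∷ reverse ps)
  upPath = IsPath-++ʳ (reverse qs) (subst IsPath eq (IsPath-reverse path))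
    where
    eq : reverse (ps ++ here ∷ qs) ≡ reverse qs ++ here ∷ reverse ps
    eq = trans (reverse-++ ps (here ∷ qs))
               (trans (cong (_++ reverse ps) (unfold-reverse here qs)) (++-assoc (reverse qs) (here ∷ []) (reverse ps)))
  disjoint : ∀ {p} → p ∈ reverse ps → p ∈ qs → ⊥
  disjoint p∈ p∈qs = unique-disjoint ps (proj₂ path) (Any.reverse⁻ p∈) (there p∈qs)
  two-arms : ∀ {t} {us vs : List (Pos t)} → IsPath (here ∷ us) → IsPath (here ∷ vs) →
    (∀ {p} → p ∈ us → p ∈ vs → ⊥) → Shape (reverse us ++ here ∷ vs)
  two-arms {us = us} {vs} up dn dis with arm up | arm dn
  ... | end | _ = vertical (descent dn)
  ... | down _ | end = subst Shape (unfold-reverse here us) (upward (descent up))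
  ... | left _ | end = subst Shape (unfold-reverse here us) (upward (descent up))
  ... | right _ | end = subst Shape (unfold-reverse here us) (upward (descent up))
  -- Two arms entering the same child would share the root of its subtree.
  ... | down _ | down _ = ⊥-elim (dis (here refl) (here refl))
  ... | left _ | left _ = ⊥-elim (dis (here refl) (here refl))
  ... | right _ | right _ = ⊥-elim (dis (here refl) (here refl))
  ... | left up′ | right dn′ = fork (descent up′) (descent dn′)
  ... | right up′ | left dn′ = fork′ (descent up′) (descent dn′)

-- Colouring stretched trees

-- Levi's lemma; it will locate the midpoint of an anagram relative to the turn of a path.
++-split : ∀ {A : Set} (as : List A) {bs cs ds} → as ++ bs ≡ cs ++ ds →
  (∃ λ es → cs ≡ as ++ es × bs ≡ es ++ ds) ⊎ (∃ λ es → as ≡ cs ++ es × ds ≡ es ++ bs)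
++-split [] {cs = cs} eq = inj₁ (cs , refl , eq)
++-split (a ∷ as) {cs = []} eq = inj₂ (a ∷ as , refl , sym eq)
++-split (a ∷ as) {cs = c ∷ cs} eq with ∷-injective eq
... | refl , eq′ with ++-split as eq′
... | inj₁ (es , p , q) = inj₁ (es , cong (a ∷_) p , q)
... | inj₂ (es , p , q) = inj₂ (es , cong (a ∷_) p , q)

total : ∀ {A : Set} → (A → ℕ) → List A → ℕ
total F xs = sum (map F xs)

total-++ : ∀ {A : Set} (F : A → ℕ) xs ys → total F (xs ++ ys) ≡ total F xs + total F ys
total-++ F xs ys = trans (cong sum (map-++ F xs ys)) (sum-++ (map F xs) (map F ys))

total-↭ : ∀ {A : Set} (F : A → ℕ) {xs ys} → xs ↭ ys → total F xs ≡ total F ys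
total-↭ F p = sum-↭ (map⁺ F p)

total-reverse : ∀ {A : Set} (F : A → ℕ) xs → total F (reverse xs) ≡ total F xs
total-reverse F xs = total-↭ F (↭-reverse xs)

module Colouring {A : Set} (w : ℕ → A) (w-free : AnagramFreeWord w) where

  Colour : Set
  Colour = Bool × A

  Counts : Set
  Counts = Bool → ℕ

  advance : Bool → Counts → Counts
  advance σ k τ = if σ == τ then suc (k τ) else k τ

  -- The colour of a vertex is the direction σ of the last turn above it, together with the next unused letter of w among
  -- the k σ ones already used for σ on the way from the root.
  colour : Bool → Counts → ∀ {t} → Pos t → Colour
  colour σ k here = σ , w (k σ)
  colour σ k (down p) = colour σ (advance σ k) p
  colour σ k (left p) = colour false (advance σ k) p
  colour σ k (right p) = colour true (advance σ k) p

  data Coherent : Counts → List Colour → Set where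
    []  : ∀ {k} → Coherent k []
    _∷_ : ∀ {k} σ {us} → Coherent (advance σ k) us → Coherent k ((σ , w (k σ)) ∷ us)

  coherent-++ˡ : ∀ us {vs k} → Coherent k (us ++ vs) → Coherent k us
  coherent-++ˡ [] _ = []
  coherent-++ˡ (_ ∷ us) (σ ∷ h) = σ ∷ coherent-++ˡ us h

  select : Bool → (A → ℕ) → Colour → ℕ
  select τ f (σ , x) = if σ == τ then f x else 0

  count : Bool → List Colour → ℕ
  count τ = total (select τ (λ _ → 1))

  -- The entries of direction `τ` spell consecutive letters of `w` from position `k τ` on, so their
  -- total is a difference of two prefix sums, stated without subtraction.
  coherent-total : ∀ τ f {us k} → Coherent k us →
    sumBelow (f ∘ w) (k τ) + total (select τ f) us ≡ sumBelow (f ∘ w) (k τ + count τ us)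
  coherent-total τ f {k = k} [] = trans (+-identityʳ _) (cong (sumBelow (f ∘ w)) (sym (+-identityʳ (k τ))))
  coherent-total true f {k = k} (_∷_ true {us} h) = begin
    sumBelow (f ∘ w) (k true) + (f (w (k true)) + total (select true f) us) ≡⟨ sym (+-assoc (sumBelow (f ∘ w) (k true)) _ _) ⟩
    sumBelow (f ∘ w) (suc (k true)) + total (select true f) us              ≡⟨ coherent-total true f h ⟩
    sumBelow (f ∘ w) (suc (k true) + count true us)                         ≡⟨ cong (sumBelow (f ∘ w)) (sym (+-suc (k true) (count true us))) ⟩
    sumBelow (f ∘ w) (k true + suc (count true us))                         ∎
    where open ≡-Reasoning
  coherent-total false f {k = k} (_∷_ false {us} h) = begin
    sumBelow (f ∘ w) (k false) + (f (w (k false)) + total (select false f) us) ≡⟨ sym (+-assoc (sumBelow (f ∘ w) (k false)) _ _) ⟩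
    sumBelow (f ∘ w) (suc (k false)) + total (select false f) us            ≡⟨ coherent-total false f h ⟩
    sumBelow (f ∘ w) (suc (k false) + count false us)                       ≡⟨ cong (sumBelow (f ∘ w)) (sym (+-suc (k false) (count false us))) ⟩
    sumBelow (f ∘ w) (k false + suc (count false us))                       ∎
    where open ≡-Reasoning
  coherent-total true f (false ∷ h) = coherent-total true f h
  coherent-total false f (true ∷ h) = coherent-total false f h

  -- The letters of one direction along a descending path form a factor of w.
  coherent-anagram : ∀ τ {k} us vs → Coherent k (us ++ vs) →
    (∀ f → total (select τ f) us ≡ total (select τ f) vs) → count τ us ≡ 0
  coherent-anagram τ {k} us vs h eq with count τ us in eqU
  ... | zero = refl
  ... | suc m = ⊥-elim (w-free (k τ) (k τ + suc m) (k τ + (suc m + suc m))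
                  (m<m+n (k τ) (s≤s z≤n)) (+-monoʳ-< (k τ) (m<m+n (suc m) (s≤s z≤n))) balanced)
    where
    eqV : count τ vs ≡ suc m
    eqV = trans (sym (eq (λ _ → 1))) eqU
    balanced : Balanced w (k τ) (k τ + suc m) (k τ + (suc m + suc m))
    balanced f = begin
      S₁ + sumBelow (f ∘ w) (k τ + (suc m + suc m))                 ≡⟨ cong (λ n → S₁ + sumBelow (f ∘ w) (k τ + n)) (sym both) ⟩
      S₁ + sumBelow (f ∘ w) (k τ + count τ (us ++ vs))              ≡⟨ cong (S₁ +_) (sym (coherent-total τ f h)) ⟩
      S₁ + (S₁ + total (select τ f) (us ++ vs))                     ≡⟨ cong (λ n → S₁ + (S₁ + n)) (total-++ (select τ f) us vs) ⟩
      S₁ + (S₁ + (U + total (select τ f) vs))                       ≡⟨ cong (λ n → S₁ + (S₁ + (U + n))) (sym (eq f)) ⟩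
      S₁ + (S₁ + (U + U))                                           ≡⟨ sym (+-assoc S₁ S₁ (U + U)) ⟩
      S₁ + S₁ + (U + U)                                             ≡⟨ interchange S₁ S₁ U U ⟩
      (S₁ + U) + (S₁ + U)                                           ≡⟨ cong₂ _+_ mid mid ⟩
      sumBelow (f ∘ w) (k τ + suc m) + sumBelow (f ∘ w) (k τ + suc m) ∎
      where
      open ≡-Reasoning
      S₁ = sumBelow (f ∘ w) (k τ)
      U = total (select τ f) us
      both : count τ (us ++ vs) ≡ suc m + suc m
      both = trans (total-++ (select τ (λ _ → 1)) us vs) (cong₂ _+_ eqU eqV)
      mid : S₁ + U ≡ sumBelow (f ∘ w) (k τ + suc m)
      mid = trans (coherent-total τ f (coherent-++ˡ us h)) (cong (λ n → sumBelow (f ∘ w) (k τ + n)) eqU)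

  count-head : ∀ u us → 0 < count (proj₁ u) (u ∷ us)
  count-head (true , _) us = s≤s z≤n
  count-head (false , _) us = s≤s z≤n

  count-0 : ∀ τ f us → count τ us ≡ 0 → total (select τ f) us ≡ 0
  count-0 τ f [] eq = refl
  count-0 true f ((false , _) ∷ us) eq = count-0 true f us eq
  count-0 false f ((true , _) ∷ us) eq = count-0 false f us eq

  -- Equality of all totals stands in for a permutation, since the arguments only ever compare
  -- weights of the two halves.
  Anagram : List Colour → Set
  Anagram us = ∃ λ x → ∃ λ vs → ∃ λ ws → us ≡ (x ∷ vs) ++ ws × (∀ F → total F (x ∷ vs) ≡ total F ws)

  anagram-reverse : ∀ us → Anagram (reverse us) → Anagram us
  anagram-reverse us (x , vs , ws , eq , tot) = go (reverse ws) refl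
    where
    us≡ : us ≡ reverse ws ++ reverse (x ∷ vs)
    us≡ = trans (sym (reverse-involutive us)) (trans (cong reverse eq) (reverse-++ (x ∷ vs) ws))
    tot′ : ∀ F → total F (reverse ws) ≡ total F (reverse (x ∷ vs))
    tot′ F = trans (total-reverse F ws) (trans (sym (tot F)) (sym (total-reverse F (x ∷ vs))))
    go : ∀ rs → rs ≡ reverse ws → Anagram us
    -- The weight 1 compares lengths, which rules out an empty second half.
    go [] e with trans (tot′ (λ _ → 1)) (total-reverse (λ _ → 1) (x ∷ vs))
    ... | e′ rewrite sym e with () ← e′
    go (r ∷ rs) e = r , rs , reverse (x ∷ vs) , trans us≡ (cong (_++ reverse (x ∷ vs)) (sym e))
                  , λ F → trans (cong (total F) e) (tot′ F)

  vertical-free : ∀ {k} us → Coherent k us → ¬ Anagram us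
  vertical-free us h (x , vs , ws , refl , tot) =
    <⇒≢ (count-head x vs) (sym (coherent-anagram (proj₁ x) (x ∷ vs) ws h (λ f → tot (select (proj₁ x) f))))

  -- The colours on a descending path that starts with an edge subdivided into L edges and turned to τ, when fewer than
  -- L vertices follow that edge; τ′ is the other direction.
  record Edge (τ τ′ : Bool) (L : ℕ) (us : List Colour) : Set where
    field
      long  : count τ′ us ≡ 0 ⊎ L ≤ count τ us
      few   : count τ′ us < L
      start : us ≡ [] ⊎ 0 < count τ us

  open Edge

  -- The turn is at `x`, and one half of the anagram is the final part `ws` of the arm of direction
  -- `τ`. The other half is the rest of that arm, `x`, and the whole arm `us` of direction `τ′`.
  uneven-fork : ∀ {k τ τ′ L x us} vs ws → ws ≢ [] → Edge τ′ τ L us → Edge τ τ′ L (vs ++ ws) →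
    Coherent k (x ∷ (vs ++ ws)) → (∀ F → total F ws ≡ total F us + total F (x ∷ vs)) → ⊥
  uneven-fork {τ = τ} {τ′} {L} {x} {us} vs ws ws≢[] eU eV h tot with long eU | start eV
  -- If `us` runs through its whole first edge, its `L` entries of direction `τ′` must be matched
  -- within `ws`, where there are too few.
  ... | inj₂ L≤ | _ = <⇒≱ (few eV) (begin
    L                                           ≤⟨ L≤ ⟩
    count τ′ us                                 ≤⟨ m≤m+n _ _ ⟩
    count τ′ us + count τ′ (x ∷ vs)             ≡⟨ sym (tot (select τ′ (λ _ → 1))) ⟩
    count τ′ ws                                 ≤⟨ m≤n+m _ (count τ′ vs) ⟩
    count τ′ vs + count τ′ ws                   ≡⟨ sym (total-++ (select τ′ (λ _ → 1)) vs ws) ⟩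
    count τ′ (vs ++ ws)                         ∎)
    where open ≤-Reasoning
  ... | inj₁ none | inj₁ empty = ws≢[] (++-conicalʳ vs ws empty)
  -- Otherwise `us` has no entries of direction `τ`, so those of `x ∷ vs` and `ws` match along one
  -- descent. Hence there are none, yet the arm starts with one.
  ... | inj₁ none | inj₂ pos = <⇒≱ pos (begin
    count τ (vs ++ ws)                          ≡⟨ total-++ one vs ws ⟩
    count τ vs + count τ ws                     ≤⟨ +-monoˡ-≤ _ (m≤n+m _ (one x)) ⟩
    count τ (x ∷ vs) + count τ ws               ≡⟨ cong₂ _+_ none′ (trans (sym (eq (λ _ → 1))) none′) ⟩
    0                                           ∎)
    where
    open ≤-Reasoning
    one : Colour → ℕ
    one = select τ (λ _ → 1)
    eq : ∀ f → total (select τ f) (x ∷ vs) ≡ total (select τ f) ws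
    eq f = sym (trans (tot (select τ f)) (cong (_+ total (select τ f) (x ∷ vs)) (count-0 τ f us none)))
    none′ : count τ (x ∷ vs) ≡ 0
    none′ = coherent-anagram τ (x ∷ vs) ws h eq

  -- The midpoint precedes the turn: reversing the first arm puts the half `y ∷ ys` at its lower end
  -- and reduces to `uneven-fork` with the directions exchanged.
  fork-free-up : ∀ {k τ τ′ L x y ys} us vs → Coherent k (x ∷ us) → Edge τ′ τ L us → Edge τ τ′ L vs →
    ∀ zs es → reverse us ≡ (y ∷ ys) ++ es → zs ≡ es ++ x ∷ vs → (∀ F → total F (y ∷ ys) ≡ total F zs) → ⊥
  fork-free-up {k} {τ} {τ′} {L} {x} {y} {ys} us vs hU eU eV zs es p q tot =
    uneven-fork (reverse es) (reverse (y ∷ ys)) nonempty eV (subst (Edge τ′ τ L) us≡ eU)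
      (subst (λ l → Coherent k (x ∷ l)) us≡ hU) sums
    where
    us≡ : us ≡ reverse es ++ reverse (y ∷ ys)
    us≡ = trans (sym (reverse-involutive us)) (trans (cong reverse p) (reverse-++ (y ∷ ys) es))
    nonempty : reverse (y ∷ ys) ≢ []
    nonempty eq with () ← trans (sym (reverse-involutive (y ∷ ys))) (cong reverse eq)
    sums : ∀ F → total F (reverse (y ∷ ys)) ≡ total F vs + total F (x ∷ reverse es)
    sums F = begin
      total F (reverse (y ∷ ys))                        ≡⟨ total-reverse F (y ∷ ys) ⟩
      total F (y ∷ ys)                                  ≡⟨ tot F ⟩
      total F zs                                        ≡⟨ cong (total F) q ⟩
      total F (es ++ x ∷ vs)                            ≡⟨ total-++ F es (x ∷ vs) ⟩
      total F es + (F x + total F vs)                   ≡⟨ sym (+-assoc (total F es) (F x) (total F vs)) ⟩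
      total F es + F x + total F vs                     ≡⟨ +-comm _ (total F vs) ⟩
      total F vs + (total F es + F x)                   ≡⟨ cong (total F vs +_) (+-comm (total F es) (F x)) ⟩
      total F vs + (F x + total F es)                   ≡⟨ cong (λ n → total F vs + (F x + n)) (sym (total-reverse F es)) ⟩
      total F vs + (F x + total F (reverse es))         ∎
      where open ≡-Reasoning

  fork-free : ∀ {k τ τ′ L x} us vs → Coherent k (x ∷ us) → Coherent k (x ∷ vs) → Edge τ′ τ L us → Edge τ τ′ L vs →
    ¬ Anagram (reverse us ++ x ∷ vs)
  fork-free {k} {τ} {τ′} {L} {x} us vs hU hV eU eV (y , ys , zs , eq , tot) with ++-split (reverse us) eq
  ... | inj₁ (e ∷ es , p , q) with ∷-injective q
  ...   | refl , q′ = uneven-fork es zs zs≢[] eU (subst (Edge τ τ′ L) q′ eV) (subst (λ l → Coherent k (x ∷ l)) q′ hV)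
    λ F → trans (sym (tot F)) (trans (cong (total F) p)
            (trans (total-++ F (reverse us) (x ∷ es)) (cong (_+ total F (x ∷ es)) (total-reverse F us))))
    where
    zs≢[] : zs ≢ []
    zs≢[] refl with () ← tot (λ _ → 1)
  -- A midpoint immediately before the turning vertex is treated as lying on the upward arm, with
  -- nothing left of that arm in the second half.
  fork-free {k} {τ} {τ′} {L} {x} us vs hU hV eU eV (y , ys , zs , eq , tot) | inj₁ ([] , p , q) =
    fork-free-up us vs hU eU eV zs [] (trans (sym (++-identityʳ (reverse us))) (trans (sym p) (sym (++-identityʳ (y ∷ ys))))) (sym q) tot
  fork-free {k} {τ} {τ′} {L} {x} us vs hU hV eU eV (y , ys , zs , eq , tot) | inj₂ (es , p , q) =
    fork-free-up us vs hU eU eV zs es p q tot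

  colours : Bool → Counts → ∀ {t} → List (Pos t) → List Colour
  colours σ k = map (colour σ k)

  descent-coherent : ∀ σ k {t} {ps : List (Pos t)} → Descent ps → Coherent k (colours σ k ps)
  descent-coherent σ k [] = []
  descent-coherent σ k stop = σ ∷ []
  descent-coherent σ k (down {ps = ps} h) = σ ∷ subst (Coherent _) (map-∘ ps) (descent-coherent σ _ h)
  descent-coherent σ k (left {ps = ps} h) = σ ∷ subst (Coherent _) (map-∘ ps) (descent-coherent false _ h)
  descent-coherent σ k (right {ps = ps} h) = σ ∷ subst (Coherent _) (map-∘ ps) (descent-coherent true _ h)

  descent-length : ∀ {t} {ps : List (Pos t)} → Descent ps → length ps ≤ suc (height t)
  descent-length [] = z≤n
  descent-length stop = s≤s z≤n
  descent-length (down {ps = ps} h) = s≤s (subst (_≤ _) (sym (length-map down ps)) (descent-length h))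
  descent-length (left {s} {t} {ps = ps} h) =
    s≤s (subst (_≤ _) (sym (length-map left ps)) (≤-trans (descent-length h) (s≤s (m≤m⊔n (height s) (height t)))))
  descent-length (right {s} {t} {ps = ps} h) =
    s≤s (subst (_≤ _) (sym (length-map right ps)) (≤-trans (descent-length h) (s≤s (m≤n⊔m (height s) (height t)))))

  count≤length : ∀ τ us → count τ us ≤ length us
  count≤length τ [] = z≤n
  count≤length true ((true , _) ∷ us) = s≤s (count≤length true us)
  count≤length false ((false , _) ∷ us) = s≤s (count≤length false us)
  count≤length true ((false , _) ∷ us) = m≤n⇒m≤1+n (count≤length true us)
  count≤length false ((true , _) ∷ us) = m≤n⇒m≤1+n (count≤length false us)

  count-here : ∀ τ k {t} (ps : List (Pos t)) → count τ (colours τ k (here ∷ ps)) ≡ suc (count τ (colours τ k ps))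
  count-here true k ps = refl
  count-here false k ps = refl

  count-here-other : ∀ {τ τ′} → (τ == τ′) ≡ false → ∀ k {t} (ps : List (Pos t)) →
    count τ′ (colours τ k (here ∷ ps)) ≡ count τ′ (colours τ k ps)
  count-here-other {τ} {τ′} ne k ps = cong (λ b → (if b then 1 else 0) + count τ′ (colours τ k ps)) ne

  count-down : ∀ τ′ τ k {t} (ps : List (Pos t)) →
    count τ′ (colours τ k (map down ps)) ≡ count τ′ (colours τ (advance τ k) ps)
  count-down τ′ τ k ps = cong (count τ′) (sym (map-∘ {g = colour τ k} {f = down} ps))

  descent-head : ∀ {t} {ps : List (Pos t)} → Descent ps → ps ≡ [] ⊎ ∃ λ qs → ps ≡ here ∷ qs
  descent-head [] = inj₁ refl
  descent-head stop = inj₂ (_ , refl)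
  descent-head (down _) = inj₂ (_ , refl)
  descent-head (left _) = inj₂ (_ , refl)
  descent-head (right _) = inj₂ (_ , refl)

  edge-start : ∀ τ k {t} {ps : List (Pos t)} → Descent ps → colours τ k ps ≡ [] ⊎ 0 < count τ (colours τ k ps)
  edge-start τ k h with descent-head h
  ... | inj₁ refl = inj₁ refl
  ... | inj₂ (qs , refl) = inj₂ (≤-trans (s≤s z≤n) (≤-reflexive (sym (count-here τ k qs))))

  -- The `d` division vertices and the child at the end of the edge all have direction `τ`. A
  -- descent meeting `τ′` has passed all `suc d` of them.
  edge-long : ∀ {τ τ′} → (τ == τ′) ≡ false → ∀ k d {t} {ps : List (Pos (chain d t))} → Descent ps →
    count τ′ (colours τ k ps) ≡ 0 ⊎ suc d ≤ count τ (colours τ k ps)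
  edge-long {τ} ne k zero h with edge-start τ k h
  ... | inj₁ empty rewrite empty = inj₁ refl
  ... | inj₂ pos = inj₂ pos
  edge-long ne k (suc d) [] = inj₁ refl
  edge-long {τ} {τ′} ne k (suc d) {t} stop = inj₁ (count-here-other {τ} {τ′} ne k {un (chain d t)} [])
  edge-long {τ} {τ′} ne k (suc d) (down {ps = ps} h) with edge-long ne (advance τ k) d h
  ... | inj₁ e = inj₁ (trans (count-here-other ne k (map down ps)) (trans (count-down τ′ τ k ps) e))
  ... | inj₂ l = inj₂ (≤-trans (s≤s l) (≤-reflexive (sym (trans (count-here τ k (map down ps)) (cong suc (count-down τ τ k ps))))))

  -- Direction `τ′` occurs only strictly below the root of `t`, where a descent has at most
  -- `height t` vertices.
  edge-few : ∀ {τ τ′} → (τ == τ′) ≡ false → ∀ k d {t} {ps : List (Pos (chain d t))} → Descent ps →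
    count τ′ (colours τ k ps) ≤ height t
  edge-few {τ} {τ′} ne k zero {t} h with descent-head h
  ... | inj₁ refl = z≤n
  ... | inj₂ (qs , refl) = begin
    count τ′ (colours τ k (here ∷ qs))   ≡⟨ count-here-other ne k qs ⟩
    count τ′ (colours τ k qs)            ≤⟨ count≤length τ′ (colours τ k qs) ⟩
    length (colours τ k qs)              ≡⟨ length-map (colour τ k) qs ⟩
    length qs                            ≤⟨ s≤s⁻¹ (descent-length h) ⟩
    height t                             ∎
    where open ≤-Reasoning
  edge-few ne k (suc d) [] = z≤n
  edge-few {τ} {τ′} ne k (suc d) {t} stop = ≤-trans (≤-reflexive (count-here-other {τ} {τ′} ne k {un (chain d t)} [])) z≤n
  edge-few {τ} {τ′} ne k (suc d) (down {ps = ps} h) =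
    ≤-trans (≤-reflexive (trans (count-here-other ne k (map down ps)) (count-down τ′ τ k ps))) (edge-few ne (advance τ k) d h)

  edge : ∀ {τ τ′} → (τ == τ′) ≡ false → ∀ k d {t} {ps : List (Pos (chain d t))} → height t ≤ d → Descent ps →
    Edge τ τ′ (suc d) (colours τ k ps)
  edge {τ} ne k d ht h = record { long = edge-long ne k d h ; few = s≤s (≤-trans (edge-few ne k d h) ht) ; start = edge-start τ k h }

  -- The two chains share one length `d`, which bounds the already stretched subtrees below them.
  -- The recursive premises concern whole chains because a path missing the branching vertex lies in
  -- one of these.
  data Stretched : BTree → Set where
    lf : Stretched lf
    un : ∀ {t} → Stretched t → Stretched (un t)
    bi : ∀ d {s t} → height s ≤ d → height t ≤ d → Stretched (chain d s) → Stretched (chain d t) →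
         Stretched (bi (chain d s) (chain d t))

  -- The direction `σ` and the counts `k` are arbitrary because the colouring of a subtree continues
  -- from those reached above it.
  path-free : ∀ {t} → Stretched t → ∀ σ k {ps : List (Pos t)} → Shape ps → ¬ Anagram (colours σ k ps)
  path-free _ σ k (vertical h) = vertical-free _ (descent-coherent σ k h)
  path-free _ σ k (upward {ps = ps} h) an =
    vertical-free _ (descent-coherent σ k h) (anagram-reverse _ (subst Anagram (reverse-map (colour σ k) ps) an))
  path-free (un st) σ k (down {ps = ps} path) an =
    path-free st σ (advance σ k) (shape path) (subst Anagram (sym (map-∘ ps)) an)
  path-free (bi d hs ht ss st) σ k (left {ps = ps} path) an =
    path-free ss false (advance σ k) (shape path) (subst Anagram (sym (map-∘ ps)) an)
  path-free (bi d hs ht ss st) σ k (right {ps = ps} path) an =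
    path-free st true (advance σ k) (shape path) (subst Anagram (sym (map-∘ ps)) an)
  path-free (bi d {s} {t} hs ht _ _) σ k (fork {ps = ps} {qs} h h′) an =
    fork-free (colours false k′ ps) (colours true k′ qs) (σ ∷ descent-coherent false k′ h) (σ ∷ descent-coherent true k′ h′)
      (edge refl k′ d hs h) (edge refl k′ d ht h′)
      (subst Anagram eq an)
    where
    k′ = advance σ k
    eq : colours σ k (reverse (map left ps) ++ here ∷ map right qs) ≡ reverse (colours false k′ ps) ++ (σ , w (k σ)) ∷ colours true k′ qs
    eq = trans (map-++ (colour σ k) (reverse (map left ps)) _)
      (cong₂ (λ us vs → us ++ (σ , w (k σ)) ∷ vs)
        (trans (reverse-map (colour σ k) (map left ps)) (cong reverse (sym (map-∘ ps)))) (sym (map-∘ qs)))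
  path-free (bi d {s} {t} hs ht _ _) σ k (fork′ {ps = ps} {qs} h h′) an =
    fork-free (colours true k′ ps) (colours false k′ qs) (σ ∷ descent-coherent true k′ h) (σ ∷ descent-coherent false k′ h′)
      (edge refl k′ d ht h) (edge refl k′ d hs h′)
      (subst Anagram eq an)
    where
    k′ = advance σ k
    eq : colours σ k (reverse (map right ps) ++ here ∷ map left qs) ≡ reverse (colours true k′ ps) ++ (σ , w (k σ)) ∷ colours false k′ qs
    eq = trans (map-++ (colour σ k) (reverse (map right ps)) _)
      (cong₂ (λ us vs → us ++ (σ , w (k σ)) ∷ vs)
        (trans (reverse-map (colour σ k) (map right ps)) (cong reverse (sym (map-∘ ps)))) (sym (map-∘ qs)))

  start-counts : Counts
  start-counts _ = 0

  stretched-anagramFree : ∀ {t} → Stretched t → AnagramFree (colour false start-counts {t})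
  stretched-anagramFree st ps path (x , vs , ws , p , eq) =
    path-free st false start-counts (shape path) (x , vs , ws , eq , λ F → sym (total-↭ F p))

-- 2 ^ n ∸ 1
chainLength : ℕ → ℕ
chainLength zero = 0
chainLength (suc n) = suc (chainLength n + chainLength n)

chainLength-mono : ∀ {m n} → m ≤ n → chainLength m ≤ chainLength n
chainLength-mono z≤n = z≤n
chainLength-mono (s≤s m≤n) = s≤s (+-mono-≤ (chainLength-mono m≤n) (chainLength-mono m≤n))

chainLength<3^ : ∀ n → chainLength n < 3 ^ n
chainLength<3^ zero = s≤s z≤n
chainLength<3^ (suc n) = begin
  suc (suc (chainLength n + chainLength n))    ≡⟨ cong suc (sym (+-suc (chainLength n) (chainLength n))) ⟩
  suc (chainLength n) + suc (chainLength n)    ≤⟨ +-mono-≤ (chainLength<3^ n) (≤-trans (chainLength<3^ n) (m≤m+n (3 ^ n) _)) ⟩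
  3 ^ suc n                                    ∎
  where open ≤-Reasoning

-- Choosing the subdivision

stretch : BTree → BTree
stretch lf = lf
stretch (un t) = un (stretch t)
stretch (bi s t) = bi (chain d (stretch s)) (chain d (stretch t))
  where d = chainLength (height s ⊔ height t)

stretch-subdivision : ∀ k n t → height t ≤ suc n → chainLength n ≤ k → SubdivisionOf k t (stretch t)
stretch-subdivision k n lf _ _ = sub-lf
-- Paths never turn at a vertex with a single child, so its edge is left undivided.
stretch-subdivision k n (un t) (s≤s ht) le = sub-un 0 z≤n (stretch-subdivision k n t (m≤n⇒m≤1+n ht) le)
stretch-subdivision k n (bi s t) (s≤s hst) le = sub-bi _ _ d≤k d≤k
  (stretch-subdivision k n s (m≤n⇒m≤1+n (≤-trans (m≤m⊔n _ _) hst)) le)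
  (stretch-subdivision k n t (m≤n⇒m≤1+n (≤-trans (m≤n⊔m _ _) hst)) le)
  where
  d≤k : chainLength (height s ⊔ height t) ≤ k
  d≤k = ≤-trans (chainLength-mono hst) le

height-chain : ∀ d t → height (chain d t) ≡ d + height t
height-chain zero t = refl
height-chain (suc d) t = cong suc (height-chain d t)

-- Below a branching vertex with subtrees of height at most `n`, an edge of length 2ⁿ is followed by
-- depth at most 2ⁿ - 1. The sum 2ⁿ⁺¹ - 1 is the recurrence defining `chainLength`.
height-stretch : ∀ t → height (stretch t) ≤ chainLength (height t)
height-stretch lf = z≤n
height-stretch (un t) = s≤s (≤-trans (height-stretch t) (m≤m+n _ _))
height-stretch (bi s t) = s≤s (⊔-lub (arm-height s (m≤m⊔n _ _)) (arm-height t (m≤n⊔m _ _)))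
  where
  d = chainLength (height s ⊔ height t)
  arm-height : ∀ r → height r ≤ height s ⊔ height t → height (chain d (stretch r)) ≤ d + d
  arm-height r le = ≤-trans (≤-reflexive (height-chain d (stretch r)))
                            (+-monoʳ-≤ d (≤-trans (height-stretch r) (chainLength-mono le)))

open Colouring word keränen-anagramFree

stretched-chain : ∀ d {t} → Stretched t → Stretched (chain d t)
stretched-chain zero st = st
stretched-chain (suc d) st = un (stretched-chain d st)

stretch-stretched : ∀ t → Stretched (stretch t)
stretch-stretched lf = lf
stretch-stretched (un t) = un (stretch-stretched t)
stretch-stretched (bi s t) = bi d (short s (m≤m⊔n _ _)) (short t (m≤n⊔m _ _))
  (stretched-chain d (stretch-stretched s)) (stretched-chain d (stretch-stretched t))
  where
  d = chainLength (height s ⊔ height t)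
  short : ∀ r → height r ≤ height s ⊔ height t → height (stretch r) ≤ d
  short r le = ≤-trans (height-stretch r) (chainLength-mono le)

-- Encoding the colours in `Fin 8`

IsAnagram-map : ∀ {A B : Set} (f : A → B) {xs} → IsAnagram xs → IsAnagram (map f xs)
IsAnagram-map f (x , ys , zs , p , refl) = f x , map f ys , map f zs , map⁺ f p , map-++ f (x ∷ ys) zs

-- Applying the left inverse `g` to an anagram in the new colours gives one in the old colours.
AnagramFree-injective : ∀ {t} {C C′ : Set} (f : C → C′) (g : C′ → C) → (∀ x → g (f x) ≡ x) →
  {c : Pos t → C} → AnagramFree c → AnagramFree (f ∘ c)
AnagramFree-injective f g gf {c} free ps path an = free ps path
  (subst IsAnagram (trans (sym (map-∘ ps)) (map-cong (gf ∘ c) ps)) (IsAnagram-map g an))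

encode : Colour → Fin 8
encode (false , x) = combine {2} zero x
encode (true , x) = combine {2} (suc zero) x

decode : Fin 8 → Colour
decode i with remQuot {2} 4 i
... | zero , x = false , x
... | suc zero , x = true , x

decode-encode : ∀ u → decode (encode u) ≡ u
decode-encode (false , x) rewrite remQuot-combine {2} zero x = refl
decode-encode (true , x) rewrite remQuot-combine {2} (suc zero) x = refl

theorem2 : (h : ℕ) → 1 ≤ h → (T : BTree) → height T ≡ h →
    Σ BTree λ S → SubdivisionOf (3 ^ (h ∸ 1) ∸ 1) T S × φ≤ S 8
theorem2 (suc n) _ T hT =
    stretch T
  , stretch-subdivision _ n T (≤-reflexive hT) (≤-pred-∸ (chainLength<3^ n))
  , encode ∘ colour false start-counts
  , AnagramFree-injective encode decode decode-encode (stretched-anagramFree (stretch-stretched T))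
  where
  ≤-pred-∸ : ∀ {m n} → m < n → m ≤ n ∸ 1
  ≤-pred-∸ (s≤s le) = le
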